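{- For all rooted transition systems $\mathscr{M}$ and $\mathscr{N}$, if there exists a functional bisimulation between $\mathscr{M}$ and $\mathscr{N}$, then the classifying toposes of their path-equivalence quotients are equivalent: $\mathcal{E}[\mathbb{T}_{\mathscr{M}/{\sim}}]\simeq\mathcal{E}[\mathbb{T}_{\mathscr{N}/{\sim}}]$.
   Context: A rooted transition system $\mathscr{M}$ consists of a set $S_\mathscr{M}$ of states, a transition relation $\to$, and an initial state $\star_\mathscr{M}$. A simulation is a function on states preserving transitions and initial states. $\to^*$ is the reflexive-transitive closure of $\to$. States $s,t$ are path-equivalent, $s\sim t$, if for all $u$: $s\to^*u\iff t\to^*u$ and $u\to^*s\iff u\to^*t$. A functional bisimulation is a pair of simulations $f:\mathscr{M}\to\mathscr{N}$, $g:\mathscr{N}\to\mathscr{M}$ with $gf(s)\sim s$ and $fg(t)\sim t$ for all states. The path-equivalence quotient $\mathscr{M}/{\sim}$ has states $S_\mathscr{M}/{\sim}$, a transition $[s_1]\to[s_2]$ whenever there are $s_1'\sim s_1$, $s_2'\sim s_2$ with $s_1'\to s_2'$, and initial state $[\star_\mathscr{M}]$. For a rooted transition system $\mathscr{M}$, $\mathbb{T}_\mathscr{M}$ is the geometric theory over the one-sorted language with a constant $c_s$ per state and binary predicates $\Delta$ (transition), $\Gamma$ (reachability), $\Theta$ (path equivalence), axiomatized by: $\Delta(x,y)\vdash\Gamma(x,y)$, $\top\vdash\Gamma(x,x)$, transitivity of $\Gamma$, an axiom defining $\Theta$, symmetry of $\Theta$, $\Theta\vdash\Gamma$; $\top\vdash\Delta(c_s,c_t)$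 for each transition $s\to t$; $\Delta(c_s,x)\vdash\bigvee_{t:\,s\to t}x=c_t$ for each state $s$; $\Gamma(c_s,c_t)\vdash\bot$ for non-reachable pairs and $\Theta(c_s,c_t)\vdash\bot$ for non-path-equivalent pairs; and domain closure $\top\vdash\bigvee_{s\in S_\mathscr{M}}x=c_s$. $\mathcal{E}[\mathbb{T}]$ is the classifying topos of $\mathbb{T}$. -}

module Defs where

open import Level using (Level; _⊔_) renaming (suc to lsuc)
open import Data.Empty.Polymorphic using (⊥)
open import Data.Fin.Base using (Fin; zero; suc; _↑ˡ_; _↑ʳ_; splitAt; join)
open import Data.Fin.Patterns using (0F; 1F; 2F)
open import Data.Fin.Properties using (join-splitAt)
open import Data.Nat.Base as ℕ using (ℕ; _+_)
open import Data.Product.Base using (Σ; ∃; ∃₂; _×_; _,_; proj₁; proj₂)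
open import Data.Sum.Base using (inj₁; inj₂; [_,_])
open import Data.Vec.Base as Vec using (Vec; []; _∷_)
open import Data.Vec.Functional using (Vector; _++_)
open import Data.Vec.Functional.Properties using (lookup-++ˡ; lookup-++ʳ)
open import Function.Base using (_∘_)
open import Function.Bundles using (Func; _⇔_)
import Function.Construct.Composition as Compose
import Function.Construct.Identity as Identity
open import Function.Properties.Equivalence using (⇔-isEquivalence)
open import Relation.Binary.Bundles using (Setoid)
open import Relation.Binary.Construct.Closure.ReflexiveTransitive using (Star)
open import Relation.Binary.Construct.Union using (_∪_)
open import Relation.Binary.Core using (Rel)
open import Relation.Binary.Definitions using (_Respects₂_)
open import Relation.Binary.PropositionalEquality
  using (_≡_; refl; sym; trans; cong; cong₂)
open import Relation.Binary.Structures using (IsEquivalence)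
open import Relation.Nullary.Negation using (¬_)

-- Sets are setoids, so that the path-equivalence quotient is again a
-- rooted transition system.

record RootedTransitionSystem ℓ : Set (lsuc ℓ) where
  field
    states : Setoid ℓ ℓ

  open Setoid states public
    using (_≈_) renaming (Carrier to State)

  field
    _⟶_      : Rel State ℓ
    ⟶-resp-≈ : _⟶_ Respects₂ _≈_
    ⋆        : State

  -- Star alone is reflexive only up to _≡_; the equality of the set of
  -- states is _≈_.
  _⟶*_ : Rel State ℓ
  _⟶*_ = Star (_≈_ ∪ _⟶_)

  _∼_ : Rel State ℓ
  s ∼ t = ∀ u → ((s ⟶* u) ⇔ (t ⟶* u)) × ((u ⟶* s) ⇔ (u ⟶* t))

  ∼-isEquivalence : IsEquivalence _∼_
  ∼-isEquivalence = record
    { refl  = λ u → E.refl , E.refl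
    ; sym   = λ p u → E.sym (proj₁ (p u)) , E.sym (proj₂ (p u))
    ; trans = λ p q u → E.trans (proj₁ (p u)) (proj₁ (q u))
                      , E.trans (proj₂ (p u)) (proj₂ (q u))
    }
    where module E {a} = IsEquivalence (⇔-isEquivalence {a})

record Simulation {ℓ} (M N : RootedTransitionSystem ℓ) : Set ℓ where
  private
    module M = RootedTransitionSystem M
    module N = RootedTransitionSystem N
  field
    func : Func M.states N.states

  open Func func public using (to)

  field
    preserves-⟶ : ∀ {s t} → s M.⟶ t → to s N.⟶ to t
    preserves-⋆ : to M.⋆ N.≈ N.⋆

record FunctionalBisimulation {ℓ} (M N : RootedTransitionSystem ℓ) : Set ℓ where
  private
    module M = RootedTransitionSystem M
    module N = RootedTransitionSystem N
  field
    f : Simulation M N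
    g : Simulation N M

  private
    module f = Simulation f
    module g = Simulation g

  field
    gf∼id : ∀ s → g.to (f.to s) M.∼ s
    fg∼id : ∀ t → f.to (g.to t) N.∼ t

_/∼ : ∀ {ℓ} → RootedTransitionSystem ℓ → RootedTransitionSystem ℓ
M /∼ = record
  { states   = record { isEquivalence = ∼-isEquivalence }
  ; _⟶_      = λ s₁ s₂ → ∃₂ λ s₁′ s₂′ → s₁′ ∼ s₁ × s₂′ ∼ s₂ × s₁′ ⟶ s₂′
  ; ⟶-resp-≈ = (λ { p (s₁′ , s₂′ , q₁ , q₂ , r) → s₁′ , s₂′ , q₁ , E.trans q₂ p , r })
             , (λ { p (s₁′ , s₂′ , q₁ , q₂ , r) → s₁′ , s₂′ , E.trans q₁ p , q₂ , r })
  ; ⋆        = ⋆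
  }
  where
  open RootedTransitionSystem M
  module E = IsEquivalence ∼-isEquivalence

record Category o h e : Set (lsuc (o ⊔ h ⊔ e)) where
  infix  4 _⇒_ _≈_
  infixr 9 _∙_
  field
    Obj : Set o
    _⇒_ : Obj → Obj → Set h
    _≈_ : ∀ {A B} → Rel (A ⇒ B) e
    id  : ∀ {A} → A ⇒ A
    _∙_ : ∀ {A B C} → B ⇒ C → A ⇒ B → A ⇒ C

    ≈-isEquivalence : ∀ {A B} → IsEquivalence (_≈_ {A} {B})
    ∙-cong    : ∀ {A B C} {f f′ : B ⇒ C} {g g′ : A ⇒ B} →
                f ≈ f′ → g ≈ g′ → f ∙ g ≈ f′ ∙ g′
    identityˡ : ∀ {A B} {f : A ⇒ B} → id ∙ f ≈ f
    identityʳ : ∀ {A B} {f : A ⇒ B} → f ∙ id ≈ f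
    assoc     : ∀ {A B C D} {f : C ⇒ D} {g : B ⇒ C} {h : A ⇒ B} →
                (f ∙ g) ∙ h ≈ f ∙ (g ∙ h)

  module Eq {A} {B} = IsEquivalence (≈-isEquivalence {A} {B})

op : ∀ {o h e} → Category o h e → Category o h e
op C = record
  { Obj = Obj
  ; _⇒_ = λ A B → B ⇒ A
  ; _≈_ = _≈_
  ; id  = id
  ; _∙_ = λ f g → g ∙ f
  ; ≈-isEquivalence = ≈-isEquivalence
  ; ∙-cong    = λ p q → ∙-cong q p
  ; identityˡ = identityʳ
  ; identityʳ = identityˡ
  ; assoc     = Eq.sym assoc
  }
  where open Category C

Setoids : ∀ κ → Category (lsuc κ) κ κ
Setoids κ = record
  { Obj = Setoid κ κ
  ; _⇒_ = Func
  ; _≈_ = λ {A} {B} f g → ∀ x → Setoid._≈_ B (Func.to f x) (Func.to g x)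
  ; id  = λ {A} → Identity.function A
  ; _∙_ = λ f g → Compose.function g f
  ; ≈-isEquivalence = λ {A} {B} → record
    { refl  = λ x → Setoid.refl B
    ; sym   = λ p x → Setoid.sym B (p x)
    ; trans = λ p q x → Setoid.trans B (p x) (q x)
    }
  ; ∙-cong    = λ {A} {B} {C} {f} {f′} {g} {g′} p q x →
                  Setoid.trans C (Func.cong f (q x)) (p (Func.to g′ x))
  ; identityˡ = λ {A} {B} x → Setoid.refl B
  ; identityʳ = λ {A} {B} x → Setoid.refl B
  ; assoc     = λ {A} {B} {C} {D} x → Setoid.refl D
  }

FullSubcategory : ∀ {o h e p} (C : Category o h e) →
                  (Category.Obj C → Set p) → Category (o ⊔ p) h e
FullSubcategory C Q = record
  { Obj = Σ Obj Q
  ; _⇒_ = λ A B → proj₁ A ⇒ proj₁ B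
  ; _≈_ = _≈_
  ; id  = id
  ; _∙_ = _∙_
  ; ≈-isEquivalence = ≈-isEquivalence
  ; ∙-cong    = ∙-cong
  ; identityˡ = identityˡ
  ; identityʳ = identityʳ
  ; assoc     = assoc
  }
  where open Category C

record Functor {o h e o′ h′ e′} (C : Category o h e) (D : Category o′ h′ e′)
               : Set (o ⊔ h ⊔ e ⊔ o′ ⊔ h′ ⊔ e′) where
  private
    module C = Category C
    module D = Category D
  field
    F₀     : C.Obj → D.Obj
    F₁     : ∀ {A B} → A C.⇒ B → F₀ A D.⇒ F₀ B
    F-cong : ∀ {A B} {f g : A C.⇒ B} → f C.≈ g → F₁ f D.≈ F₁ g
    F-id   : ∀ {A} → F₁ (C.id {A}) D.≈ D.id
    F-∙    : ∀ {A B E} {f : B C.⇒ E} {g : A C.⇒ B} → F₁ (f C.∙ g) D.≈ F₁ f D.∙ F₁ g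

idF : ∀ {o h e} {C : Category o h e} → Functor C C
idF {C = C} = record
  { F₀ = λ A → A ; F₁ = λ f → f ; F-cong = λ p → p ; F-id = Eq.refl ; F-∙ = Eq.refl }
  where open Category C

_∘F_ : ∀ {o h e o′ h′ e′ o″ h″ e″} {C : Category o h e} {D : Category o′ h′ e′}
       {E : Category o″ h″ e″} → Functor D E → Functor C D → Functor C E
_∘F_ {E = E} G F = record
  { F₀     = λ A → G.F₀ (F.F₀ A)
  ; F₁     = λ f → G.F₁ (F.F₁ f)
  ; F-cong = λ p → G.F-cong (F.F-cong p)
  ; F-id   = E.Eq.trans (G.F-cong F.F-id) G.F-id
  ; F-∙    = E.Eq.trans (G.F-cong F.F-∙) G.F-∙
  }
  where
  module E = Category E
  module F = Functor F
  module G = Functor G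

record NaturalTransformation {o h e o′ h′ e′} {C : Category o h e} {D : Category o′ h′ e′}
                             (F G : Functor C D) : Set (o ⊔ h ⊔ h′ ⊔ e′) where
  private
    module C = Category C
    module D = Category D
    module F = Functor F
    module G = Functor G
  field
    η       : ∀ A → F.F₀ A D.⇒ G.F₀ A
    natural : ∀ {A B} (f : A C.⇒ B) → η B D.∙ F.F₁ f D.≈ G.F₁ f D.∙ η A

Functors : ∀ {o h e o′ h′ e′} (C : Category o h e) (D : Category o′ h′ e′) →
           Category (o ⊔ h ⊔ e ⊔ o′ ⊔ h′ ⊔ e′) (o ⊔ h ⊔ h′ ⊔ e′) (o ⊔ e′)
Functors C D = record
  { Obj = Functor C D
  ; _⇒_ = NaturalTransformation
  ; _≈_ = λ α β → ∀ A → η α A ≈ η β A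
  ; id  = record
    { η       = λ A → id
    ; natural = λ f → Eq.trans identityˡ (Eq.sym identityʳ)
    }
  ; _∙_ = λ α β → record
    { η       = λ A → η α A ∙ η β A
    ; natural = λ f → Eq.trans assoc (Eq.trans (∙-cong Eq.refl (natural β f))
                     (Eq.trans (Eq.sym assoc) (Eq.trans (∙-cong (natural α f) Eq.refl) assoc)))
    }
  ; ≈-isEquivalence = record
    { refl  = λ A → Eq.refl
    ; sym   = λ p A → Eq.sym (p A)
    ; trans = λ p q A → Eq.trans (p A) (q A)
    }
  ; ∙-cong    = λ p q A → ∙-cong (p A) (q A)
  ; identityˡ = λ A → identityˡ
  ; identityʳ = λ A → identityʳ
  ; assoc     = λ A → assoc
  }
  where
  open Category D
  open NaturalTransformation

record Isomorphism {o h e} (C : Category o h e) (A B : Category.Obj C) : Set (h ⊔ e) where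
  open Category C
  field
    from : A ⇒ B
    to   : B ⇒ A
    to∙from≈id : to ∙ from ≈ id
    from∙to≈id : from ∙ to ≈ id

-- A geometric morphism of toposes is an equivalence exactly when its
-- underlying functors are an equivalence of categories, and every
-- equivalence of categories between toposes underlies one.

infix 4 _≃_

record _≃_ {o h e o′ h′ e′} (C : Category o h e) (D : Category o′ h′ e′)
           : Set (o ⊔ h ⊔ e ⊔ o′ ⊔ h′ ⊔ e′) where
  field
    F    : Functor C D
    G    : Functor D C
    G∘F≅ : Isomorphism (Functors C C) (G ∘F F) idF
    F∘G≅ : Isomorphism (Functors D D) (F ∘F G) idF

record Family {o h e} (ι : Level) (C : Category o h e) (U : Category.Obj C)
              : Set (o ⊔ h ⊔ lsuc ι) where
  open Category C
  field
    Index  : Set ι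
    source : Index → Obj
    arrow  : ∀ i → source i ⇒ U

module _ {o h e} {C : Category o h e} where
  open Category C

  -- Pullbacks are not used: compatibility is tested on all commuting squares,
  -- so this is the sheaf condition for the sieve generated by the family.

  module _ {κ ι} (P : Functor (op C) (Setoids κ)) {U : Obj} (S : Family ι C U) where
    open Functor P
    open Family S

    private
      module P A = Setoid (F₀ A)

    restrict : ∀ {A B} → A ⇒ B → P.Carrier B → P.Carrier A
    restrict f = Func.to (F₁ f)

    Compatible : (∀ i → P.Carrier (source i)) → Set (o ⊔ h ⊔ e ⊔ κ ⊔ ι)
    Compatible x = ∀ {V} i j (g : V ⇒ source i) (h : V ⇒ source j) →
      arrow i ∙ g ≈ arrow j ∙ h → P._≈_ V (restrict g (x i)) (restrict h (x j))

    Amalgamates : (∀ i → P.Carrier (source i)) → P.Carrier U → Set (κ ⊔ ι)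
    Amalgamates x y = ∀ i → P._≈_ (source i) (restrict (arrow i) y) (x i)

    IsSheafFor : Set (o ⊔ h ⊔ e ⊔ κ ⊔ ι)
    IsSheafFor = ∀ x → Compatible x →
      Σ (P.Carrier U) λ y → Amalgamates x y × (∀ y′ → Amalgamates x y′ → P._≈_ U y y′)

Sheaves : ∀ {o h e ι j} (κ : Level) (C : Category o h e) →
          (∀ {U} → Family ι C U → Set j) →
          Category (o ⊔ h ⊔ e ⊔ lsuc ι ⊔ j ⊔ lsuc κ) (o ⊔ h ⊔ κ) (o ⊔ κ)
Sheaves κ C Covers = FullSubcategory (Functors (op C) (Setoids κ))
  λ P → ∀ {U} (S : Family _ C U) → Covers S → IsSheafFor P S

-- One-sorted signatures whose only function symbols are constants.

record Signature ℓ : Set (lsuc ℓ) where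
  field
    Constants : Setoid ℓ ℓ
    Relation  : ℕ → Set ℓ

  open Setoid Constants public
    using () renaming (Carrier to Constant; _≈_ to _≈ᶜ_)

module Syntax {ℓ} (𝓢 : Signature ℓ) where
  open Signature 𝓢

  data Term (n : ℕ) : Set ℓ where
    var : Fin n → Term n
    con : Constant → Term n

  Subst : ℕ → ℕ → Set ℓ
  Subst m n = Vector (Term n) m

  infixl 10 _⟪_⟫ _[_]
  infixl 9 _⨟_

  _⟪_⟫ : ∀ {m n} → Term m → Subst m n → Term n
  var i ⟪ σ ⟫ = σ i
  con c ⟪ σ ⟫ = con c

  _⨟_ : ∀ {m n p} → Subst m n → Subst n p → Subst m p
  (σ ⨟ τ) i = σ i ⟪ τ ⟫

  lift : ∀ {m n} → Subst m n → Subst (ℕ.suc m) (ℕ.suc n)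
  lift σ zero    = var zero
  lift σ (suc i) = σ i ⟪ var ∘ suc ⟫

  infix  8 _≐_ _≐ⁿ_
  infixr 7 _∧_

  -- Formulas in a context of n variables; disjunctions are ℓ-small, and the
  -- quantifier ∃′ binds variable zero.

  data Formula (n : ℕ) : Set (lsuc ℓ) where
    rel : ∀ {k} → Relation k → Vec (Term n) k → Formula n
    _≐_ : Term n → Term n → Formula n
    ⊤′  : Formula n
    _∧_ : Formula n → Formula n → Formula n
    ⋁   : (I : Set ℓ) → (I → Formula n) → Formula n
    ∃′  : Formula (ℕ.suc n) → Formula n

  _[_] : ∀ {m n} → Formula m → Subst m n → Formula n
  rel R ts [ σ ] = rel R (Vec.map (_⟪ σ ⟫) ts)
  (t ≐ u)  [ σ ] = t ⟪ σ ⟫ ≐ u ⟪ σ ⟫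
  ⊤′       [ σ ] = ⊤′
  (φ ∧ ψ)  [ σ ] = φ [ σ ] ∧ ψ [ σ ]
  ⋁ I φ    [ σ ] = ⋁ I λ i → φ i [ σ ]
  ∃′ φ     [ σ ] = ∃′ (φ [ lift σ ])

  ⊥′ : ∀ {n} → Formula n
  ⊥′ = ⋁ ⊥ λ ()

  ⋀ : ∀ {m n} → Vector (Formula n) m → Formula n
  ⋀ {ℕ.zero}  φ = ⊤′
  ⋀ {ℕ.suc m} φ = φ zero ∧ ⋀ (φ ∘ suc)

  _≐ⁿ_ : ∀ {m n} → Vector (Term n) m → Vector (Term n) m → Formula n
  ts ≐ⁿ us = ⋀ λ i → ts i ≐ us i

  -- In context m + n the first m variables are the ones ∃ⁿ m binds.

  ∃ⁿ : ∀ m {n} → Formula (m + n) → Formula n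
  ∃ⁿ ℕ.zero    φ = φ
  ∃ⁿ (ℕ.suc m) φ = ∃ⁿ m (∃′ φ)

record Theory ℓ : Set (lsuc (lsuc ℓ)) where
  field
    signature : Signature ℓ
  open Syntax signature
  field
    Axiom : ∀ {n} → Rel (Formula n) (lsuc ℓ)

module Logic {ℓ} (𝕋 : Theory ℓ) where
  open Theory 𝕋
  open Signature signature public
  open Syntax signature public

  infix 4 _⊢_ _⊣⊢_

  -- φ ⊢ ψ, for formulas in a context of n variables: the sequent is derivable
  -- from the axioms of 𝕋.  Two names of one constant are equal by ≐-con.

  data _⊢_ : ∀ {n} → Formula n → Formula n → Set (lsuc ℓ) where
    axiom   : ∀ {n} {φ ψ : Formula n} → Axiom φ ψ → φ ⊢ ψ
    ⊢-refl  : ∀ {n} {φ : Formula n} → φ ⊢ φ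
    cut     : ∀ {n} {φ ψ χ : Formula n} → φ ⊢ ψ → ψ ⊢ χ → φ ⊢ χ
    sub     : ∀ {m n} {φ ψ : Formula m} (σ : Subst m n) → φ ⊢ ψ → φ [ σ ] ⊢ ψ [ σ ]
    ≐-refl  : ∀ {n} {t : Term n} → ⊤′ ⊢ t ≐ t
    ≐-con   : ∀ {n} {c d : Constant} → c ≈ᶜ d → ⊤′ {n} ⊢ con c ≐ con d
    ≐-subst : ∀ {m n} (φ : Formula m) (σ τ : Subst m n) → (σ ≐ⁿ τ) ∧ φ [ σ ] ⊢ φ [ τ ]
    ⊤-intro : ∀ {n} {φ : Formula n} → φ ⊢ ⊤′
    ∧-elimˡ : ∀ {n} {φ ψ : Formula n} → φ ∧ ψ ⊢ φ
    ∧-elimʳ : ∀ {n} {φ ψ : Formula n} → φ ∧ ψ ⊢ ψ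
    ∧-intro : ∀ {n} {χ φ ψ : Formula n} → χ ⊢ φ → χ ⊢ ψ → χ ⊢ φ ∧ ψ
    ⋁-intro : ∀ {n I} {φ : I → Formula n} (i : I) → φ i ⊢ ⋁ I φ
    ⋁-elim  : ∀ {n I} {φ : I → Formula n} {χ} → (∀ i → φ i ⊢ χ) → ⋁ I φ ⊢ χ
    ∃-intro : ∀ {n} {φ : Formula (ℕ.suc n)} {ψ : Formula n} →
              ∃′ φ ⊢ ψ → φ ⊢ ψ [ var ∘ suc ]
    ∃-elim  : ∀ {n} {φ : Formula (ℕ.suc n)} {ψ : Formula n} →
              φ ⊢ ψ [ var ∘ suc ] → ∃′ φ ⊢ ψ
    distributive : ∀ {n I} {φ : Formula n} {ψ : I → Formula n} →
                   φ ∧ ⋁ I ψ ⊢ ⋁ I λ i → φ ∧ ψ i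
    frobenius    : ∀ {n} {φ : Formula n} {ψ : Formula (ℕ.suc n)} →
                   φ ∧ ∃′ ψ ⊢ ∃′ (φ [ var ∘ suc ] ∧ ψ)

  _⊣⊢_ : ∀ {n} → Rel (Formula n) (lsuc ℓ)
  φ ⊣⊢ ψ = φ ⊢ ψ × ψ ⊢ φ

  by-≡ : ∀ {n} {φ ψ : Formula n} → φ ≡ ψ → φ ⊢ ψ
  by-≡ refl = ⊢-refl

  ⋀-intro : ∀ {m n} {χ : Formula n} {φ : Vector (Formula n) m} → (∀ i → χ ⊢ φ i) → χ ⊢ ⋀ φ
  ⋀-intro {ℕ.zero}  p = ⊤-intro
  ⋀-intro {ℕ.suc m} p = ∧-intro (p zero) (⋀-intro (p ∘ suc))

  ⋀-elim : ∀ {m n} {φ : Vector (Formula n) m} i → ⋀ φ ⊢ φ i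
  ⋀-elim zero    = ∧-elimˡ
  ⋀-elim (suc i) = cut ∧-elimʳ (⋀-elim i)

  ⋀-[] : ∀ {m n p} (φ : Vector (Formula n) m) (σ : Subst n p) →
         ⋀ φ [ σ ] ≡ ⋀ λ i → φ i [ σ ]
  ⋀-[] {ℕ.zero}  φ σ = refl
  ⋀-[] {ℕ.suc m} φ σ = cong (φ zero [ σ ] ∧_) (⋀-[] (φ ∘ suc) σ)

  ≐-by-≡ : ∀ {n} {χ : Formula n} {t u : Term n} → t ≡ u → χ ⊢ t ≐ u
  ≐-by-≡ refl = cut ⊤-intro ≐-refl

  transport : ∀ {m n} (φ : Formula m) {σ τ : Subst m n} {χ : Formula n} →
              (∀ i → χ ⊢ σ i ≐ τ i) → χ ⊢ φ [ σ ] → χ ⊢ φ [ τ ]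
  transport φ e p = cut (∧-intro (⋀-intro e) p) (≐-subst φ _ _)

  ++-≐ : ∀ {m n p} {us us′ : Subst m p} {ts ts′ : Subst n p} {χ : Formula p} →
         (∀ i → χ ⊢ us i ≐ us′ i) → (∀ i → χ ⊢ ts i ≐ ts′ i) →
         ∀ i → χ ⊢ (us ++ ts) i ≐ (us′ ++ ts′) i
  ++-≐ {m} e f i with splitAt m i
  ... | inj₁ j = e j
  ... | inj₂ j = f j

  []-cong : ∀ {m n} (φ : Formula m) {σ τ : Subst m n} {χ : Formula n} →
            (∀ i → σ i ≡ τ i) → χ ⊢ φ [ σ ] → χ ⊢ φ [ τ ]
  []-cong φ e = transport φ (λ i → ≐-by-≡ (e i))

  ≐-sym : ∀ {n} {χ : Formula n} {t u : Term n} → χ ⊢ t ≐ u → χ ⊢ u ≐ t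
  ≐-sym {t = t} {u} p = transport {2} (var 0F ≐ var 1F)
    {σ = λ { 0F → t ; 1F → t }} {τ = λ { 0F → u ; 1F → t }}
    (λ { 0F → p ; 1F → ≐-by-≡ refl }) (≐-by-≡ refl)

  ≐-trans : ∀ {n} {χ : Formula n} {t u v : Term n} → χ ⊢ t ≐ u → χ ⊢ u ≐ v → χ ⊢ t ≐ v
  ≐-trans {t = t} {u} {v} p q = transport {2} (var 0F ≐ var 1F)
    {σ = λ { 0F → t ; 1F → u }} {τ = λ { 0F → t ; 1F → v }}
    (λ { 0F → ≐-by-≡ refl ; 1F → q }) p

  ∃-mono : ∀ {n} {φ ψ : Formula (ℕ.suc n)} → φ ⊢ ψ → ∃′ φ ⊢ ∃′ ψ
  ∃-mono p = ∃-elim (cut p (∃-intro ⊢-refl))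

  ⋁-mono : ∀ {n I} {φ ψ : I → Formula n} → (∀ i → φ i ⊢ ψ i) → ⋁ I φ ⊢ ⋁ I ψ
  ⋁-mono p = ⋁-elim λ i → cut (p i) (⋁-intro i)

  ∧-mono : ∀ {n} {φ φ′ ψ ψ′ : Formula n} → φ ⊢ φ′ → ψ ⊢ ψ′ → φ ∧ ψ ⊢ φ′ ∧ ψ′
  ∧-mono p q = ∧-intro (cut ∧-elimˡ p) (cut ∧-elimʳ q)

  ⟪⟫-⟪⟫ : ∀ {m n p} (t : Term m) {σ : Subst m n} {τ : Subst n p} {υ : Subst m p} →
          (∀ i → σ i ⟪ τ ⟫ ≡ υ i) → t ⟪ σ ⟫ ⟪ τ ⟫ ≡ t ⟪ υ ⟫
  ⟪⟫-⟪⟫ (var i) e = e i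
  ⟪⟫-⟪⟫ (con c) e = refl

  map-⟪⟫-⟪⟫ : ∀ {m n p k} (ts : Vec (Term m) k)
              {σ : Subst m n} {τ : Subst n p} {υ : Subst m p} →
              (∀ i → σ i ⟪ τ ⟫ ≡ υ i) →
              Vec.map (_⟪ τ ⟫) (Vec.map (_⟪ σ ⟫) ts) ≡ Vec.map (_⟪ υ ⟫) ts
  map-⟪⟫-⟪⟫ []       e = refl
  map-⟪⟫-⟪⟫ (t ∷ ts) e = cong₂ _∷_ (⟪⟫-⟪⟫ t e) (map-⟪⟫-⟪⟫ ts e)

  lift-⟪⟫ : ∀ {m n p} {σ : Subst m n} {τ : Subst n p} {υ : Subst m p} →
            (∀ i → σ i ⟪ τ ⟫ ≡ υ i) → ∀ i → lift σ i ⟪ lift τ ⟫ ≡ lift υ i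
  lift-⟪⟫ e zero = refl
  lift-⟪⟫ {σ = σ} {τ} {υ} e (suc i) =
    trans (lemma (σ i)) (cong (_⟪ var ∘ suc ⟫) (e i))
    where
    lemma : ∀ t → t ⟪ var ∘ suc ⟫ ⟪ lift τ ⟫ ≡ t ⟪ τ ⟫ ⟪ var ∘ suc ⟫
    lemma (var j) = refl
    lemma (con c) = refl

  -- Propositional equality would need function extensionality under ⋁.

  [][] : ∀ {m n p} (φ : Formula m) {σ : Subst m n} {τ : Subst n p} {υ : Subst m p} →
         (∀ i → σ i ⟪ τ ⟫ ≡ υ i) → φ [ σ ] [ τ ] ⊣⊢ φ [ υ ]
  [][] (rel R ts) e = by-≡ (cong (rel R) (map-⟪⟫-⟪⟫ ts e))
                    , by-≡ (cong (rel R) (sym (map-⟪⟫-⟪⟫ ts e)))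
  [][] (t ≐ u) e = by-≡ (cong₂ _≐_ (⟪⟫-⟪⟫ t e) (⟪⟫-⟪⟫ u e))
                 , by-≡ (sym (cong₂ _≐_ (⟪⟫-⟪⟫ t e) (⟪⟫-⟪⟫ u e)))
  [][] ⊤′ e = ⊢-refl , ⊢-refl
  [][] (φ ∧ ψ) e = ∧-mono (proj₁ ([][] φ e)) (proj₁ ([][] ψ e))
                 , ∧-mono (proj₂ ([][] φ e)) (proj₂ ([][] ψ e))
  [][] (⋁ I φ) e = ⋁-mono (λ i → proj₁ ([][] (φ i) e))
                 , ⋁-mono (λ i → proj₂ ([][] (φ i) e))
  [][] (∃′ φ) e = ∃-mono (proj₁ ([][] φ (lift-⟪⟫ e)))
                , ∃-mono (proj₂ ([][] φ (lift-⟪⟫ e)))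

  ⟪var⟫ : ∀ {n} (t : Term n) {σ : Subst n n} → (∀ i → σ i ≡ var i) → t ⟪ σ ⟫ ≡ t
  ⟪var⟫ (var i) e = e i
  ⟪var⟫ (con c) e = refl

  map-⟪var⟫ : ∀ {n k} (ts : Vec (Term n) k) {σ : Subst n n} → (∀ i → σ i ≡ var i) →
              Vec.map (_⟪ σ ⟫) ts ≡ ts
  map-⟪var⟫ []       e = refl
  map-⟪var⟫ (t ∷ ts) e = cong₂ _∷_ (⟪var⟫ t e) (map-⟪var⟫ ts e)

  [var] : ∀ {n} (φ : Formula n) {σ : Subst n n} → (∀ i → σ i ≡ var i) → φ [ σ ] ⊣⊢ φ
  [var] (rel R ts) e = by-≡ (cong (rel R) (map-⟪var⟫ ts e))
                     , by-≡ (cong (rel R) (sym (map-⟪var⟫ ts e)))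
  [var] (t ≐ u) e = by-≡ (cong₂ _≐_ (⟪var⟫ t e) (⟪var⟫ u e))
                  , by-≡ (sym (cong₂ _≐_ (⟪var⟫ t e) (⟪var⟫ u e)))
  [var] ⊤′ e = ⊢-refl , ⊢-refl
  [var] (φ ∧ ψ) e = ∧-mono (proj₁ ([var] φ e)) (proj₁ ([var] ψ e))
                  , ∧-mono (proj₂ ([var] φ e)) (proj₂ ([var] ψ e))
  [var] (⋁ I φ) e = ⋁-mono (λ i → proj₁ ([var] (φ i) e))
                  , ⋁-mono (λ i → proj₂ ([var] (φ i) e))
  [var] {n} (∃′ φ) {σ} e = ∃-mono (proj₁ ([var] φ lift-e)) , ∃-mono (proj₂ ([var] φ lift-e))
    where
    lift-e : ∀ i → lift σ i ≡ var i
    lift-e zero    = refl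
    lift-e (suc i) = cong (_⟪ var ∘ suc ⟫) (e i)

  wkⁿ : ∀ m {n} → Subst n (m + n)
  wkⁿ m i = var (m ↑ʳ i)

  genⁿ : ∀ m {n} → Vector (Term (m + n)) m
  genⁿ m {n} i = var (i ↑ˡ n)

  gen++wk : ∀ m {n} i → (genⁿ m {n} ++ wkⁿ m) i ≡ var i
  gen++wk m {n} i = trans (lemma (splitAt m i)) (cong var (join-splitAt m n i))
    where
    lemma : ∀ s → [ genⁿ m {n} , wkⁿ m ] s ≡ var (join m n s)
    lemma (inj₁ j) = refl
    lemma (inj₂ j) = refl

  ++-⨟ : ∀ {m n p q} (us : Subst m p) (ts : Subst n p) (ρ : Subst p q) i →
         (us ++ ts) i ⟪ ρ ⟫ ≡ ((us ⨟ ρ) ++ (ts ⨟ ρ)) i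
  ++-⨟ {m} us ts ρ i with splitAt m i
  ... | inj₁ j = refl
  ... | inj₂ j = refl

  ∃ⁿ-elim-raw : ∀ m {n} {θ : Formula (m + n)} {ψ : Formula n} →
                θ ⊢ ψ [ wkⁿ m ] → ∃ⁿ m θ ⊢ ψ
  ∃ⁿ-elim-raw ℕ.zero    {ψ = ψ} p = cut p (proj₁ ([var] ψ (λ _ → refl)))
  ∃ⁿ-elim-raw (ℕ.suc m) {ψ = ψ} p =
    ∃ⁿ-elim-raw m (∃-elim (cut p (proj₂ ([][] ψ (λ _ → refl)))))

  ∃ⁿ-unit : ∀ m {n} {θ : Formula (m + n)} → θ ⊢ ∃ⁿ m θ [ wkⁿ m ]
  ∃ⁿ-unit ℕ.zero    {θ = θ} = proj₂ ([var] θ (λ _ → refl))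
  ∃ⁿ-unit (ℕ.suc m) {θ = θ} = cut (∃-intro ⊢-refl)
    (cut (sub (var ∘ suc) (∃ⁿ-unit m)) (proj₁ ([][] (∃ⁿ m (∃′ θ)) (λ _ → refl))))

  ∃ⁿ-intro : ∀ m {n p} (θ : Formula (m + n)) {σ : Subst n p} {χ : Formula p}
             (ts : Vector (Term p) m) → χ ⊢ θ [ ts ++ σ ] → χ ⊢ ∃ⁿ m θ [ σ ]
  ∃ⁿ-intro m θ {σ} ts p = cut p (cut (sub (ts ++ σ) (∃ⁿ-unit m))
    (proj₁ ([][] (∃ⁿ m θ) (lookup-++ʳ ts σ))))

  ∃ⁿ-mono : ∀ m {n} {θ θ′ : Formula (m + n)} → θ ⊢ θ′ → ∃ⁿ m θ ⊢ ∃ⁿ m θ′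
  ∃ⁿ-mono ℕ.zero    p = p
  ∃ⁿ-mono (ℕ.suc m) p = ∃ⁿ-mono m (∃-mono p)

  ∃ⁿ-frobenius : ∀ m {n} {φ : Formula n} {θ : Formula (m + n)} →
                 φ ∧ ∃ⁿ m θ ⊢ ∃ⁿ m (φ [ wkⁿ m ] ∧ θ)
  ∃ⁿ-frobenius ℕ.zero    {φ = φ} = ∧-mono (proj₂ ([var] φ (λ _ → refl))) ⊢-refl
  ∃ⁿ-frobenius (ℕ.suc m) {φ = φ} = cut (∃ⁿ-frobenius m)
    (∃ⁿ-mono m (cut frobenius (∃-mono (∧-mono (proj₁ ([][] φ (λ _ → refl))) ⊢-refl))))

  liftⁿ : ∀ m {n p} → Subst n p → Subst (m + n) (m + p)
  liftⁿ ℕ.zero    σ = σ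
  liftⁿ (ℕ.suc m) σ = lift (liftⁿ m σ)

  ∃ⁿ-[] : ∀ m {n p} (θ : Formula (m + n)) (σ : Subst n p) →
          ∃ⁿ m θ [ σ ] ≡ ∃ⁿ m (θ [ liftⁿ m σ ])
  ∃ⁿ-[] ℕ.zero    θ σ = refl
  ∃ⁿ-[] (ℕ.suc m) θ σ = ∃ⁿ-[] m (∃′ θ) σ

  liftⁿ-gen : ∀ m {n p} (σ : Subst n p) i → liftⁿ m σ i ≡ (genⁿ m ++ (σ ⨟ wkⁿ m)) i
  liftⁿ-gen ℕ.zero    σ i       = sym (⟪var⟫ (σ i) (λ _ → refl))
  liftⁿ-gen (ℕ.suc m) σ zero    = refl
  liftⁿ-gen (ℕ.suc m) {n} {p} σ (suc i) =
    trans (cong (_⟪ var ∘ suc ⟫) (liftⁿ-gen m σ i)) (lemma i)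
    where
    lemma : ∀ i → (genⁿ m ++ (σ ⨟ wkⁿ m)) i ⟪ var ∘ suc ⟫ ≡
                  (genⁿ (ℕ.suc m) ++ (σ ⨟ wkⁿ (ℕ.suc m))) (suc i)
    lemma i with splitAt m i
    ... | inj₁ j = refl
    ... | inj₂ j = ⟪⟫-⟪⟫ (σ j) (λ _ → refl)

  -- To use an existential, pass to an arbitrary extension ξ of the current
  -- context and hypothesis in which a witness ys is given.

  ∃ⁿ-elim : ∀ m {n p} (θ : Formula (m + n)) {σ : Subst n p} {χ ψ : Formula p} →
            χ ⊢ ∃ⁿ m θ [ σ ] →
            (∀ {q} {ξ : Formula q} (ρ : Subst p q) (ys : Vector (Term q) m) →
              ξ ⊢ χ [ ρ ] → ξ ⊢ θ [ ys ++ (σ ⨟ ρ) ] → ξ ⊢ ψ [ ρ ]) →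
            χ ⊢ ψ
  ∃ⁿ-elim m θ {σ} p k = cut (∧-intro ⊢-refl (cut p (by-≡ (∃ⁿ-[] m θ σ))))
    (cut (∃ⁿ-frobenius m) (∃ⁿ-elim-raw m
      (k (wkⁿ m) (genⁿ m) ∧-elimˡ ([]-cong θ (liftⁿ-gen m σ) ∧-elimʳ))))

  weaken : ∀ {n p q} (φ : Formula n) {σ : Subst n p} {χ : Formula p} {ξ : Formula q}
           {ρ : Subst p q} → ξ ⊢ χ [ ρ ] → χ ⊢ φ [ σ ] → ξ ⊢ φ [ σ ⨟ ρ ]
  weaken φ {ρ = ρ} w p = cut w (cut (sub ρ p) (proj₁ ([][] φ (λ _ → refl))))

  weaken₂ : ∀ m {n p q} (θ : Formula (m + n)) {us : Subst m p} {ts : Subst n p}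
            {χ : Formula p} {ξ : Formula q} {ρ : Subst p q} →
            ξ ⊢ χ [ ρ ] → χ ⊢ θ [ us ++ ts ] → ξ ⊢ θ [ (us ⨟ ρ) ++ (ts ⨟ ρ) ]
  weaken₂ m θ {us} {ts} {ρ = ρ} w p = []-cong θ (++-⨟ us ts ρ) (weaken θ w p)

  weaken-≐ : ∀ {p q} {t u : Term p} {χ : Formula p} {ξ : Formula q} {ρ : Subst p q} →
             ξ ⊢ χ [ ρ ] → χ ⊢ t ≐ u → ξ ⊢ t ⟪ ρ ⟫ ≐ u ⟪ ρ ⟫
  weaken-≐ {ρ = ρ} w p = cut w (sub ρ p)

  fuse : ∀ {n p q} (φ : Formula n) {σ : Subst n p} {ξ : Formula q} {ρ : Subst p q} →
         ξ ⊢ φ [ σ ⨟ ρ ] → ξ ⊢ φ [ σ ] [ ρ ]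
  fuse φ p = cut p (proj₂ ([][] φ (λ _ → refl)))

  fuse₂ : ∀ m {n p q} (θ : Formula (m + n)) {us : Subst m p} {ts : Subst n p}
          {ξ : Formula q} {ρ : Subst p q} →
          ξ ⊢ θ [ (us ⨟ ρ) ++ (ts ⨟ ρ) ] → ξ ⊢ θ [ us ++ ts ] [ ρ ]
  fuse₂ m θ {us} {ts} {ρ = ρ} p = fuse θ ([]-cong θ (λ i → sym (++-⨟ us ts ρ i)) p)

module SyntacticSite {ℓ} (𝕋 : Theory ℓ) where
  open Logic 𝕋

  record Object : Set (lsuc ℓ) where
    constructor ⟨_∣_⟩
    field
      ctx : ℕ
      fml : Formula ctx
  open Object

  -- θ(y , x) lives in context ctx Y + ctx X, the variables y of Y first.

  Functional : ∀ m n → Formula (m + n) → Set (lsuc ℓ)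
  Functional m n θ = θ [ y₁ ++ x ] ∧ θ [ y₂ ++ x ] ⊢ y₁ ≐ⁿ y₂
    where
    y₁ y₂ : Vector (Term (m + (m + n))) m
    y₁ = genⁿ m
    y₂ = genⁿ m ⨟ wkⁿ m
    x : Vector (Term (m + (m + n))) n
    x = wkⁿ m ⨟ wkⁿ m

  record Morphism (X Y : Object) : Set (lsuc ℓ) where
    field
      graph      : Formula (ctx Y + ctx X)
      bounded    : graph ⊢ fml X [ wkⁿ (ctx Y) ] ∧ fml Y [ genⁿ (ctx Y) ]
      total      : fml X ⊢ ∃ⁿ (ctx Y) graph
      functional : Functional (ctx Y) (ctx X) graph

  open Morphism

  module _ {X Y : Object} (θ : Morphism X Y) where

    bounded-dom : ∀ {p} {us : Subst (ctx Y) p} {ts : Subst (ctx X) p} {χ : Formula p} →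
                  χ ⊢ graph θ [ us ++ ts ] → χ ⊢ fml X [ ts ]
    bounded-dom {us = us} {ts} p = cut p (cut (sub (us ++ ts) (cut (bounded θ) ∧-elimˡ))
      (proj₁ ([][] (fml X) (lookup-++ʳ us ts))))

    bounded-cod : ∀ {p} {us : Subst (ctx Y) p} {ts : Subst (ctx X) p} {χ : Formula p} →
                  χ ⊢ graph θ [ us ++ ts ] → χ ⊢ fml Y [ us ]
    bounded-cod {us = us} {ts} p = cut p (cut (sub (us ++ ts) (cut (bounded θ) ∧-elimʳ))
      (proj₁ ([][] (fml Y) (lookup-++ˡ us ts))))

    total-at : ∀ {p} {ts : Subst (ctx X) p} {χ : Formula p} →
               χ ⊢ fml X [ ts ] → χ ⊢ ∃ⁿ (ctx Y) (graph θ) [ ts ]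
    total-at {ts = ts} p = cut p (sub ts (total θ))

    functional-at : ∀ {p} {us us′ : Subst (ctx Y) p} {ts : Subst (ctx X) p} {χ : Formula p} →
                    χ ⊢ graph θ [ us ++ ts ] → χ ⊢ graph θ [ us′ ++ ts ] →
                    ∀ i → χ ⊢ us i ≐ us′ i
    functional-at {p} {us} {us′} {ts} {χ} a b i =
      cut (cut (∧-intro a′ b′) (sub σ (cut (functional θ) (⋀-elim i))))
          (by-≡ (cong₂ _≐_ (e₁ i) (e₂ i)))
      where
      m = ctx Y
      σ : Subst (m + (m + ctx X)) p
      σ = us ++ (us′ ++ ts)
      e₁ : ∀ i → genⁿ m i ⟪ σ ⟫ ≡ us i
      e₁ = lookup-++ˡ us (us′ ++ ts)
      e₂ : ∀ i → (genⁿ m ⨟ wkⁿ m) i ⟪ σ ⟫ ≡ us′ i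
      e₂ i = trans (lookup-++ʳ us (us′ ++ ts) (i ↑ˡ ctx X)) (lookup-++ˡ us′ ts i)
      e₃ : ∀ i → (wkⁿ m ⨟ wkⁿ m) i ⟪ σ ⟫ ≡ ts i
      e₃ i = trans (lookup-++ʳ us (us′ ++ ts) (m ↑ʳ i)) (lookup-++ʳ us′ ts i)
      ++-≡ : ∀ {k l} {as as′ : Subst k p} {bs bs′ : Subst l p} →
             (∀ i → as i ≡ as′ i) → (∀ i → bs i ≡ bs′ i) → ∀ i → (as ++ bs) i ≡ (as′ ++ bs′) i
      ++-≡ {k} e f i with splitAt k i
      ... | inj₁ j = e j
      ... | inj₂ j = f j
      a′ : χ ⊢ graph θ [ genⁿ m ++ (wkⁿ m ⨟ wkⁿ m) ] [ σ ]
      a′ = fuse₂ (ctx Y) (graph θ) ([]-cong (graph θ) (++-≡ (λ i → sym (e₁ i)) (λ i → sym (e₃ i))) a)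
      b′ : χ ⊢ graph θ [ (genⁿ m ⨟ wkⁿ m) ++ (wkⁿ m ⨟ wkⁿ m) ] [ σ ]
      b′ = fuse₂ (ctx Y) (graph θ) ([]-cong (graph θ) (++-≡ (λ i → sym (e₂ i)) (λ i → sym (e₃ i))) b)

  generic : ∀ m {n} (θ : Formula (m + n)) → θ ⊢ θ [ genⁿ m ++ wkⁿ m ]
  generic m θ = proj₂ ([var] θ (gen++wk m))

  mkMorphism : ∀ {X Y} (θ : Formula (ctx Y + ctx X)) →
    (∀ {p} {us : Subst (ctx Y) p} {ts : Subst (ctx X) p} {χ : Formula p} →
      χ ⊢ θ [ us ++ ts ] → χ ⊢ fml X [ ts ] × χ ⊢ fml Y [ us ]) →
    (∀ {p} {ts : Subst (ctx X) p} {χ : Formula p} →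
      χ ⊢ fml X [ ts ] → χ ⊢ ∃ⁿ (ctx Y) θ [ ts ]) →
    (∀ {p} {us us′ : Subst (ctx Y) p} {ts : Subst (ctx X) p} {χ : Formula p} →
      χ ⊢ θ [ us ++ ts ] → χ ⊢ θ [ us′ ++ ts ] → ∀ i → χ ⊢ us i ≐ us′ i) →
    Morphism X Y
  mkMorphism {X} {Y} θ b t f = record
    { graph      = θ
    ; bounded    = let bd = b (generic (ctx Y) θ) in ∧-intro (proj₁ bd) (proj₂ bd)
    ; total      = cut (t (proj₂ ([var] (fml X) (λ _ → refl))))
                       (proj₁ ([var] (∃ⁿ (ctx Y) θ) (λ _ → refl)))
    ; functional = ⋀-intro (f ∧-elimˡ ∧-elimʳ)
    }

  ⊢-pointwise : ∀ m {n} (θ θ′ : Formula (m + n)) →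
    (∀ {p} {us : Subst m p} {ts : Subst n p} {χ : Formula p} →
      χ ⊢ θ [ us ++ ts ] → χ ⊢ θ′ [ us ++ ts ]) →
    θ ⊢ θ′
  ⊢-pointwise m θ θ′ k = cut (k (generic m θ)) (proj₁ ([var] θ′ (gen++wk m)))

  -- The identity on {x . φ} is φ(x) ∧ y ≐ x.

  idᶠ : ∀ X → Formula (ctx X + ctx X)
  idᶠ X = fml X [ wkⁿ (ctx X) ] ∧ (genⁿ (ctx X) ≐ⁿ wkⁿ (ctx X))

  module _ (X : Object) {p} {us ts : Subst (ctx X) p} {χ : Formula p} where
    private n = ctx X

    idᶠ-intro : χ ⊢ fml X [ ts ] → (∀ i → χ ⊢ us i ≐ ts i) → χ ⊢ idᶠ X [ us ++ ts ]
    idᶠ-intro a e = ∧-intro (cut a (proj₂ ([][] (fml X) (lookup-++ʳ us ts))))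
      (cut (⋀-intro λ i → cut (e i) (by-≡ (sym (cong₂ _≐_ (lookup-++ˡ us ts i) (lookup-++ʳ us ts i)))))
           (by-≡ (sym (⋀-[] (λ i → genⁿ n i ≐ wkⁿ n i) (us ++ ts)))))

    idᶠ-fml : χ ⊢ idᶠ X [ us ++ ts ] → χ ⊢ fml X [ ts ]
    idᶠ-fml p = cut p (cut ∧-elimˡ (proj₁ ([][] (fml X) (lookup-++ʳ us ts))))

    idᶠ-eq : χ ⊢ idᶠ X [ us ++ ts ] → ∀ i → χ ⊢ us i ≐ ts i
    idᶠ-eq p i = cut p (cut ∧-elimʳ
      (cut (by-≡ (⋀-[] (λ i → genⁿ n i ≐ wkⁿ n i) (us ++ ts)))
      (cut (⋀-elim i) (by-≡ (cong₂ _≐_ (lookup-++ˡ us ts i) (lookup-++ʳ us ts i))))))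

  idᴹ : ∀ {X} → Morphism X X
  idᴹ {X} = mkMorphism (idᶠ X)
    (λ a → idᶠ-fml X a
         , transport (fml X) (λ i → ≐-sym (idᶠ-eq X a i)) (idᶠ-fml X a))
    (λ {_} {ts} a → ∃ⁿ-intro (ctx X) (idᶠ X) ts (idᶠ-intro X a (λ i → ≐-by-≡ refl)))
    (λ a b i → ≐-trans (idᶠ-eq X a i) (≐-sym (idᶠ-eq X b i)))

  -- The composite of θ(y , x) and θ′(z , y) is ∃ y . θ(y , x) ∧ θ′(z , y), whose
  -- body is in the context y , z , x.

  compᵇ : ∀ k m n → Formula (k + m) → Formula (m + n) → Formula (m + (k + n))
  compᵇ k m n θ′ θ = θ [ genⁿ m ++ (wkⁿ k ⨟ wkⁿ m) ] ∧ θ′ [ (genⁿ k ⨟ wkⁿ m) ++ genⁿ m ]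

  compᶠ : ∀ k m n → Formula (k + m) → Formula (m + n) → Formula (k + n)
  compᶠ k m n θ′ θ = ∃ⁿ m (compᵇ k m n θ′ θ)

  module _ (k m n : ℕ) (θ′ : Formula (k + m)) (θ : Formula (m + n)) where

    module _ {p} (zs : Subst k p) (ys : Subst m p) (xs : Subst n p) where
      private
        σ : Subst (m + (k + n)) p
        σ = ys ++ (zs ++ xs)

      comp-inst₁ : ∀ i → (genⁿ m ++ (wkⁿ k ⨟ wkⁿ m)) i ⟪ σ ⟫ ≡ (ys ++ xs) i
      comp-inst₁ i with splitAt m i
      ... | inj₁ j = lookup-++ˡ ys (zs ++ xs) j
      ... | inj₂ j = trans (lookup-++ʳ ys (zs ++ xs) (k ↑ʳ j)) (lookup-++ʳ zs xs j)

      comp-inst₂ : ∀ i → ((genⁿ k ⨟ wkⁿ m) ++ genⁿ m) i ⟪ σ ⟫ ≡ (zs ++ ys) i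
      comp-inst₂ i with splitAt k i
      ... | inj₁ j = trans (lookup-++ʳ ys (zs ++ xs) (j ↑ˡ n)) (lookup-++ˡ zs xs j)
      ... | inj₂ j = lookup-++ˡ ys (zs ++ xs) j

    comp-intro : ∀ {p} {zs : Subst k p} {xs : Subst n p} {χ : Formula p} (ys : Subst m p) →
                 χ ⊢ θ [ ys ++ xs ] → χ ⊢ θ′ [ zs ++ ys ] →
                 χ ⊢ compᶠ k m n θ′ θ [ zs ++ xs ]
    comp-intro {zs = zs} {xs} ys a b = ∃ⁿ-intro m (compᵇ k m n θ′ θ) ys
      (∧-intro (cut a (proj₂ ([][] θ (comp-inst₁ zs ys xs))))
               (cut b (proj₂ ([][] θ′ (comp-inst₂ zs ys xs)))))

    comp-elim : ∀ {p} {zs : Subst k p} {xs : Subst n p} {χ ψ : Formula p} →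
                χ ⊢ compᶠ k m n θ′ θ [ zs ++ xs ] →
                (∀ {q} {ξ : Formula q} (ρ : Subst p q) (ys : Subst m q) → ξ ⊢ χ [ ρ ] →
                  ξ ⊢ θ [ ys ++ (xs ⨟ ρ) ] → ξ ⊢ θ′ [ (zs ⨟ ρ) ++ ys ] → ξ ⊢ ψ [ ρ ]) →
                χ ⊢ ψ
    comp-elim {zs = zs} {xs} a c = ∃ⁿ-elim m (compᵇ k m n θ′ θ) a λ ρ ys w b →
      let b′ = []-cong (compᵇ k m n θ′ θ) (++-≡ ys ρ) b in
      c ρ ys w (cut b′ (cut ∧-elimˡ (proj₁ ([][] θ (comp-inst₁ (zs ⨟ ρ) ys (xs ⨟ ρ))))))
               (cut b′ (cut ∧-elimʳ (proj₁ ([][] θ′ (comp-inst₂ (zs ⨟ ρ) ys (xs ⨟ ρ))))))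
      where
      ++-≡ : ∀ {q} (ys : Subst m q) ρ i →
             (ys ++ ((zs ++ xs) ⨟ ρ)) i ≡ (ys ++ ((zs ⨟ ρ) ++ (xs ⨟ ρ))) i
      ++-≡ ys ρ i with splitAt m i
      ... | inj₁ j = refl
      ... | inj₂ j = ++-⨟ zs xs ρ j

  infixr 9 _∙ᴹ_

  _∙ᴹ_ : ∀ {X Y Z} → Morphism Y Z → Morphism X Y → Morphism X Z
  _∙ᴹ_ {X} {Y} {Z} θ′ θ = mkMorphism (compᶠ k m n (graph θ′) (graph θ))
    (λ a → elim a (λ ρ ys w b c → fuse (fml X) (bounded-dom θ b))
         , elim a (λ ρ ys w b c → fuse (fml Z) (bounded-cod θ′ c)))
    (λ a → (∃ⁿ-elim m (graph θ) (total-at θ a) λ ρ ys w b → fuse (∃ⁿ k comp)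
      (∃ⁿ-elim k (graph θ′) (total-at θ′ (bounded-cod θ b)) λ ρ′ zs w′ c → fuse (∃ⁿ k comp)
        (∃ⁿ-intro k comp zs
          (comp-intro k m n (graph θ′) (graph θ) (ys ⨟ ρ′) (weaken₂ m (graph θ) w′ b) c)))))
    (λ a a′ i → elim a λ ρ ys w b c → elim (weaken₂ k comp w a′) λ ρ′ ys′ w′ b′ c′ →
      functional-at θ′ (weaken₂ k (graph θ′) w′ c)
        (transport (graph θ′)
          (++-≐ (λ _ → ≐-by-≡ refl) (functional-at θ b′ (weaken₂ m (graph θ) w′ b))) c′) i)
    where
    n = ctx X
    m = ctx Y
    k = ctx Z
    comp : Formula (k + n)
    comp = compᶠ k m n (graph θ′) (graph θ)
    elim : ∀ {p} {zs : Subst k p} {xs : Subst n p} {χ ψ : Formula p} →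
      χ ⊢ comp [ zs ++ xs ] →
      (∀ {q} {ξ : Formula q} (ρ : Subst p q) (ys : Subst m q) → ξ ⊢ χ [ ρ ] →
        ξ ⊢ graph θ [ ys ++ (xs ⨟ ρ) ] → ξ ⊢ graph θ′ [ (zs ⨟ ρ) ++ ys ] → ξ ⊢ ψ [ ρ ]) →
      χ ⊢ ψ
    elim = comp-elim k m n (graph θ′) (graph θ)

  infix 4 _≈ᴹ_

  _≈ᴹ_ : ∀ {X Y} → Rel (Morphism X Y) (lsuc ℓ)
  θ ≈ᴹ θ′ = graph θ ⊣⊢ graph θ′

  -- Comparable functional relations are equivalent.

  ≈ᴹ-by-⊢ : ∀ {X Y} (θ θ′ : Morphism X Y) →
    (∀ {p} {us : Subst (ctx Y) p} {ts : Subst (ctx X) p} {χ : Formula p} →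
      χ ⊢ graph θ [ us ++ ts ] → χ ⊢ graph θ′ [ us ++ ts ]) →
    θ ≈ᴹ θ′
  ≈ᴹ-by-⊢ {X} {Y} θ θ′ k =
    ⊢-pointwise (ctx Y) (graph θ) (graph θ′) k ,
    ⊢-pointwise (ctx Y) (graph θ′) (graph θ) λ a →
      ∃ⁿ-elim (ctx Y) (graph θ) (total-at θ (bounded-dom θ′ a)) λ ρ ys w b →
      fuse₂ (ctx Y) (graph θ) (transport (graph θ)
        (++-≐ (functional-at θ′ (k b) (weaken₂ (ctx Y) (graph θ′) w a)) (λ _ → ≐-by-≡ refl)) b)

  syntacticCategory : Category (lsuc ℓ) (lsuc ℓ) (lsuc ℓ)
  syntacticCategory = record
    { Obj = Object
    ; _⇒_ = Morphism
    ; _≈_ = _≈ᴹ_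
    ; id  = idᴹ
    ; _∙_ = _∙ᴹ_
    ; ≈-isEquivalence = record
      { refl  = ⊢-refl , ⊢-refl
      ; sym   = λ (p , q) → q , p
      ; trans = λ (p , q) (p′ , q′) → cut p p′ , cut q′ q
      }
    ; ∙-cong = λ {_} {_} {C} {f} {f′} {g} {g′} (p , _) (q , _) → ≈ᴹ-by-⊢ (f ∙ᴹ g) (f′ ∙ᴹ g′) λ a →
        elim f g a λ ρ ys w b c → fuse₂ (ctx C) (graph (f′ ∙ᴹ g′))
          (intro f′ g′ ys (cut b (sub _ q)) (cut c (sub _ p)))
    ; identityˡ = λ {_} {Y} {f} → ≈ᴹ-by-⊢ (idᴹ ∙ᴹ f) f λ a →
        elim idᴹ f a λ ρ ys w b c → fuse₂ (ctx Y) (graph f) (transport (graph f)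
          (++-≐ (λ i → ≐-sym (idᶠ-eq Y c i)) (λ _ → ≐-by-≡ refl)) b)
    ; identityʳ = λ {X} {Y} {f} → ≈ᴹ-by-⊢ (f ∙ᴹ idᴹ) f λ a →
        elim f idᴹ a λ ρ ys w b c → fuse₂ (ctx Y) (graph f) (transport (graph f)
          (++-≐ (λ _ → ≐-by-≡ refl) (idᶠ-eq X b)) c)
    ; assoc = λ {_} {B} {_} {D} {f} {g} {h} → ≈ᴹ-by-⊢ ((f ∙ᴹ g) ∙ᴹ h) (f ∙ᴹ (g ∙ᴹ h)) λ a →
        elim (f ∙ᴹ g) h a λ ρ ys w b c → fuse₂ (ctx D) (graph (f ∙ᴹ (g ∙ᴹ h)))
          (elim f g c λ ρ′ ys′ w′ b′ c′ → fuse₂ (ctx D) (graph (f ∙ᴹ (g ∙ᴹ h)))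
            (intro f (g ∙ᴹ h) ys′ (intro g h (ys ⨟ ρ′) (weaken₂ (ctx B) (graph h) w′ b) b′) c′))
    }
    where
    elim : ∀ {X Y Z} (f : Morphism Y Z) (g : Morphism X Y)
      {p} {zs : Subst (ctx Z) p} {xs : Subst (ctx X) p} {χ ψ : Formula p} →
      χ ⊢ graph (f ∙ᴹ g) [ zs ++ xs ] →
      (∀ {q} {ξ : Formula q} (ρ : Subst p q) (ys : Subst (ctx Y) q) → ξ ⊢ χ [ ρ ] →
        ξ ⊢ graph g [ ys ++ (xs ⨟ ρ) ] → ξ ⊢ graph f [ (zs ⨟ ρ) ++ ys ] → ξ ⊢ ψ [ ρ ]) →
      χ ⊢ ψ
    elim f g = comp-elim _ _ _ (graph f) (graph g)
    intro : ∀ {X Y Z} (f : Morphism Y Z) (g : Morphism X Y)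
      {p} {zs : Subst (ctx Z) p} {xs : Subst (ctx X) p} {χ : Formula p} (ys : Subst (ctx Y) p) →
      χ ⊢ graph g [ ys ++ xs ] → χ ⊢ graph f [ zs ++ ys ] → χ ⊢ graph (f ∙ᴹ g) [ zs ++ xs ]
    intro f g = comp-intro _ _ _ (graph f) (graph g)

  -- The image of θ(y , x), a formula in y: ∃ x . θ(y , x).

  image : ∀ {X Y} → Morphism X Y → Formula (ctx Y)
  image {X} {Y} θ = ∃ⁿ (ctx X) (graph θ [ wkⁿ (ctx X) ++ genⁿ (ctx X) ])

  -- An ℓ-small family covers {y . ψ} when ψ entails the disjunction of the
  -- images of its members.  These families are stable under pullback, so their
  -- sheaves are those of the topology they generate.

  Covers : ∀ {U} → Family ℓ syntacticCategory U → Set (lsuc ℓ)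
  Covers {U} S = fml U ⊢ ⋁ Index λ i → image (arrow i)
    where open Family S

-- A theory has ℓ-small disjunctions, so its syntactic category is (lsuc ℓ)-small:
-- this is the classifying topos relative to the universe of (lsuc ℓ)-small sets.

ClassifyingTopos : ∀ {ℓ} → Theory ℓ → Category (lsuc (lsuc ℓ)) (lsuc ℓ) (lsuc ℓ)
ClassifyingTopos {ℓ} 𝕋 = Sheaves (lsuc ℓ) syntacticCategory Covers
  where open SyntacticSite 𝕋

data Predicate {ℓ} : ℕ → Set ℓ where
  `Δ `Γ `Θ : Predicate 2

module TransitionTheory {ℓ} (M : RootedTransitionSystem ℓ) where
  open RootedTransitionSystem M

  signature : Signature ℓ
  signature = record { Constants = states ; Relation = Predicate }

  open Syntax signature

  Δ Γ Θ : ∀ {n} → Term n → Term n → Formula n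
  Δ t u = rel `Δ (t ∷ u ∷ [])
  Γ t u = rel `Γ (t ∷ u ∷ [])
  Θ t u = rel `Θ (t ∷ u ∷ [])

  private
    x : ∀ {n} → Term (1 + n)
    x = var 0F
    y : ∀ {n} → Term (2 + n)
    y = var 1F
    z : ∀ {n} → Term (3 + n)
    z = var 2F

  data Axiom : ∀ {n} → Rel (Formula n) (lsuc ℓ) where
    Δ⊢Γ      : Axiom {2} (Δ x y) (Γ x y)
    Γ-refl   : Axiom {1} ⊤′ (Γ x x)
    Γ-trans  : Axiom {3} (Γ x y ∧ Γ y z) (Γ x z)
    Θ-def⇒   : Axiom {2} (Θ x y) (Γ x y ∧ Γ y x)
    Θ-def⇐   : Axiom {2} (Γ x y ∧ Γ y x) (Θ x y)
    Θ-sym    : Axiom {2} (Θ x y) (Θ y x)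
    Θ⊢Γ      : Axiom {2} (Θ x y) (Γ x y)
    Δ-step   : ∀ {s t} → s ⟶ t → Axiom {0} ⊤′ (Δ (con s) (con t))
    Δ-target : ∀ s → Axiom {1} (Δ (con s) x) (⋁ (∃ λ t → s ⟶ t) λ (t , _) → x ≐ con t)
    ¬Γ       : ∀ {s t} → ¬ (s ⟶* t) → Axiom {0} (Γ (con s) (con t)) ⊥′
    ¬Θ       : ∀ {s t} → ¬ (s ∼ t) → Axiom {0} (Θ (con s) (con t)) ⊥′
    domain-closure : Axiom {1} ⊤′ (⋁ State λ s → x ≐ con s)

𝕋 : ∀ {ℓ} → RootedTransitionSystem ℓ → Theory ℓ
𝕋 M = record { signature = signature ; Axiom = Axiom }
  where open TransitionTheory M

{-# OPTIONS --safe #-}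

-- Path equivalence is mutual reachability, so simulations respect it, and a
-- functional bisimulation makes M /∼ and N /∼ isomorphic transition systems.
-- Renaming constants along such an isomorphism translates the theories into each
-- other, and going back and forth changes a formula only up to provable
-- equivalence.  The syntactic categories are therefore equivalent by functors
-- that preserve covers, and precomposition with these is an equivalence of the
-- categories of sheaves.

module Submission where

open import Defs

open import Data.Fin.Base using (zero; suc; splitAt)
open import Data.Nat.Base as ℕ using (ℕ; _+_)
open import Data.Product.Base using (_,_; proj₁; proj₂)
open import Data.Sum.Base using (inj₁; inj₂)
open import Data.Vec.Base as Vec using (Vec; []; _∷_; lookup; tabulate)
open import Data.Vec.Functional using (Vector; _++_)
open import Data.Vec.Properties using (lookup-map; tabulate∘lookup; tabulate-∘)
open import Function.Base using (_∘_)
open import Function.Bundles using (Func; mk⇔; module Equivalence)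
open import Level using (Level) renaming (suc to lsuc)
open import Relation.Binary.Bundles using (Setoid)
open import Relation.Binary.Construct.Closure.ReflexiveTransitive
  using (ε; _◅_; _◅◅_; gmap)
open import Relation.Binary.PropositionalEquality
  using (_≡_; refl; sym; trans; cong; cong₂)

-- Categories of sheaves

opF : ∀ {o h e o′ h′ e′} {C : Category o h e} {D : Category o′ h′ e′} →
      Functor C D → Functor (op C) (op D)
opF F = record { F₀ = F₀ ; F₁ = F₁ ; F-cong = F-cong ; F-id = F-id ; F-∙ = F-∙ }
  where open Functor F

≃-sym : ∀ {o h e o′ h′ e′} {C : Category o h e} {D : Category o′ h′ e′} → C ≃ D → D ≃ C
≃-sym E = record { F = G ; G = F ; G∘F≅ = F∘G≅ ; F∘G≅ = G∘F≅ }
  where open _≃_ E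

-- Fullness and faithfulness of equivalences

module IsomorphicToIdentity {o h e} {C : Category o h e} (H : Functor C C)
                            (α : Isomorphism (Functors C C) H idF) where
  open Category C
  open Functor H
  open Isomorphism α
  module from = NaturalTransformation from
  module to = NaturalTransformation to

  -- Naturality of `from`, composed with `to.η A` and cancelled by `from∙to≈id`. It recovers `f`
  -- from `F₁ f`, which makes `H` faithful.
  unconjugate : ∀ {A B} (f : A ⇒ B) → f ≈ from.η B ∙ (F₁ f ∙ to.η A)
  unconjugate {A} f = Eq.trans (Eq.sym identityʳ)
    (Eq.trans (∙-cong Eq.refl (Eq.sym (from∙to≈id A)))
    (Eq.trans (Eq.sym assoc) (Eq.trans (∙-cong (Eq.sym (from.natural f)) Eq.refl) assoc)))

  conjugate : ∀ {A B} (f : A ⇒ B) → F₁ f ≈ to.η B ∙ (f ∙ from.η A)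
  conjugate {B = B} f = Eq.trans (Eq.sym identityˡ)
    (Eq.trans (∙-cong (Eq.sym (to∙from≈id B)) Eq.refl)
    (Eq.trans assoc (∙-cong Eq.refl (from.natural f))))

  faithful : ∀ {A B} {f g : A ⇒ B} → F₁ f ≈ F₁ g → f ≈ g
  faithful {f = f} {g} p = Eq.trans (unconjugate f)
    (Eq.trans (∙-cong Eq.refl (∙-cong p Eq.refl)) (Eq.sym (unconjugate g)))

  -- `conjugate` puts `to` and `from` around the argument of `F₁`, where they cancel against the
  -- inner pair. This is fullness of `H`.
  conjugate⁻¹ : ∀ {A B} (f : F₀ A ⇒ F₀ B) → F₁ (from.η B ∙ (f ∙ to.η A)) ≈ f
  conjugate⁻¹ {A} {B} f = Eq.trans (conjugate _)
    (Eq.trans (∙-cong Eq.refl (Eq.trans assoc (∙-cong Eq.refl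
      (Eq.trans assoc (Eq.trans (∙-cong Eq.refl (to∙from≈id A)) identityʳ)))))
    (Eq.trans (Eq.sym assoc) (Eq.trans (∙-cong (to∙from≈id B) Eq.refl) identityˡ)))

module EquivalenceProperties {o h e o′ h′ e′} {C : Category o h e} {D : Category o′ h′ e′}
                             (E : C ≃ D) where
  open _≃_ E
  private
    module C = Category C
    module D = Category D
    module F = Functor F
    module G = Functor G
    module GF = IsomorphicToIdentity (G ∘F F) G∘F≅
    module FG = IsomorphicToIdentity (F ∘F G) F∘G≅

  F-faithful : ∀ {A B} {f g : A C.⇒ B} → F.F₁ f D.≈ F.F₁ g → f C.≈ g
  F-faithful p = GF.faithful (G.F-cong p)

  G-faithful : ∀ {A B} {f g : A D.⇒ B} → G.F₁ f C.≈ G.F₁ g → f D.≈ g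
  G-faithful p = FG.faithful (F.F-cong p)

  F-preimage : ∀ {A B} → F.F₀ A D.⇒ F.F₀ B → A C.⇒ B
  F-preimage {A} {B} h = GF.from.η B C.∙ (G.F₁ h C.∙ GF.to.η A)

  -- As `G` is faithful, the equation may be checked after applying `G`, where `conjugate⁻¹` for
  -- `G ∘F F` gives it.
  F-full : ∀ {A B} (h : F.F₀ A D.⇒ F.F₀ B) → F.F₁ (F-preimage h) D.≈ h
  F-full h = G-faithful (GF.conjugate⁻¹ (G.F₁ h))

-- Transport of families and sheaves along an equivalence

mapFamily : ∀ {ι o h e o′ h′ e′} {C : Category o h e} {D : Category o′ h′ e′}
            (F : Functor C D) {U : Category.Obj C} → Family ι C U → Family ι D (Functor.F₀ F U)
mapFamily F S = record
  { Index = Index ; source = λ i → F₀ (source i) ; arrow = λ i → F₁ (arrow i) }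
  where
  open Functor F
  open Family S

module _ {o h e o′ h′ e′} {κ ι : Level} {C : Category o h e} {D : Category o′ h′ e′} (E : C ≃ D) where
  open _≃_ E
  open EquivalenceProperties E
  private
    module C = Category C
    module D = Category D
    module F = Functor F
    module G = Functor G
    module FG = Isomorphism F∘G≅
    module from = NaturalTransformation FG.from
    module to = NaturalTransformation FG.to

  -- A square in D over the image of a family is brought into C by replacing its
  -- vertex V with F (G V), since F is full and faithful.

  sheafFor-∘ : (P : Functor (op D) (Setoids κ)) {U : C.Obj} (S : Family ι C U) →
               IsSheafFor P (mapFamily F S) → IsSheafFor (P ∘F opF F) S
  -- Elements, restrictions and amalgamations over `S` are by definition those of `P` over the image
  -- family. Only compatibility asks more, as squares in `D` have arbitrary vertices.
  sheafFor-∘ P S sheaf x compatible = sheaf x λ {V} i j g h p →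
    let module PV = Setoid (P.F₀ V)
        ε = from.η V
        ε⁻¹ = to.η V
        g′ = F-preimage (g D.∙ ε)
        h′ = F-preimage (h D.∙ ε)

        square : arrow i C.∙ g′ C.≈ arrow j C.∙ h′
        square = F-faithful
          (D.Eq.trans F.F-∙ (D.Eq.trans (D.∙-cong D.Eq.refl (F-full (g D.∙ ε)))
          (D.Eq.trans (D.Eq.sym D.assoc) (D.Eq.trans (D.∙-cong p D.Eq.refl)
          (D.Eq.trans D.assoc (D.Eq.sym
            (D.Eq.trans F.F-∙ (D.∙-cong D.Eq.refl (F-full (h D.∙ ε))))))))))

        -- `k` equals `(k ∙ ε) ∙ ε⁻¹`, so restriction along it factors through restriction along the
        -- image of an arrow of `C`.
        through : ∀ {A} (k : V D.⇒ F.F₀ A) y →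
          Func.to (P.F₁ k) y PV.≈ Func.to (P.F₁ ε⁻¹) (Func.to (P.F₁ (F.F₁ (F-preimage (k D.∙ ε)))) y)
        through k y = PV.trans (P.F-cong
          (D.Eq.trans (D.Eq.sym D.identityʳ)
          (D.Eq.trans (D.∙-cong D.Eq.refl (D.Eq.sym (FG.from∙to≈id V)))
          (D.Eq.trans (D.Eq.sym D.assoc)
            (D.∙-cong (D.Eq.sym (F-full (k D.∙ ε))) D.Eq.refl)))) y)
          (P.F-∙ y)
    in PV.trans (through g (x i))
      (PV.trans (Func.cong (P.F₁ ε⁻¹) (compatible i j g′ h′ square))
                (PV.sym (through h (x j))))
    where
    open Family S
    module P = Functor P

IsSheaf : ∀ {o h e ι j κ} (C : Category o h e) → (∀ {U} → Family ι C U → Set j) →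
          Functor (op C) (Setoids κ) → Set _
IsSheaf {ι = ι} C J P = ∀ {U} (S : Family ι C U) → J S → IsSheafFor P S

Continuous : ∀ {o h e o′ h′ e′ ι j j′} κ {C : Category o h e} {D : Category o′ h′ e′}
             (J : ∀ {U} → Family ι C U → Set j) (K : ∀ {U} → Family ι D U → Set j′) →
             Functor C D → Set _
Continuous κ {C} {D} J K F =
  ∀ (P : Functor (op D) (Setoids κ)) → IsSheaf D K P → IsSheaf C J (P ∘F opF F)

module _ {o h e o′ h′ e′ ι j j′ κ} {C : Category o h e} {D : Category o′ h′ e′}
         (J : ∀ {U} → Family ι C U → Set j) (K : ∀ {U} → Family ι D U → Set j′)
         (F : Functor C D) (continuous : Continuous κ J K F) where
  private
    module F = Functor F

  precompose : Functor (Sheaves κ D K) (Sheaves κ C J)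
  precompose = record
    { F₀     = λ (P , sheaf) → P ∘F opF F , continuous P sheaf
    ; F₁     = λ α → record
      { η       = λ A → NaturalTransformation.η α (F.F₀ A)
      ; natural = λ f → NaturalTransformation.natural α (F.F₁ f)
      }
    ; F-cong = λ p A → p (F.F₀ A)
    ; F-id   = λ {(P , _)} A x → Setoid.refl (Functor.F₀ P (F.F₀ A))
    ; F-∙    = λ {_} {_} {(P , _)} A x → Setoid.refl (Functor.F₀ P (F.F₀ A))
    }

module _ {o h e o′ h′ e′ ι j j′ κ} {C : Category o h e} {D : Category o′ h′ e′}
         (J : ∀ {U} → Family ι C U → Set j) (K : ∀ {U} → Family ι D U → Set j′)
         (F : Functor C D) (G : Functor D C)
         (F-continuous : Continuous κ J K F) (G-continuous : Continuous κ K J G)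
         (G∘F≅ : Isomorphism (Functors C C) (G ∘F F) idF) where
  private
    module C = Category C
    module GF = Isomorphism G∘F≅
    module H = Functor (G ∘F F)

    F* : Functor (Sheaves κ D K) (Sheaves κ C J)
    F* = precompose J K F F-continuous
    G* : Functor (Sheaves κ C J) (Sheaves κ D K)
    G* = precompose K J G G-continuous

  private module _ (P : Functor (op C) (Setoids κ)) where
    open Functor P

    square : ∀ {A B A′ B′} {f : A C.⇒ B} {f′ : A′ C.⇒ B′} {a : A C.⇒ A′} {b : B C.⇒ B′} →
             b C.∙ f C.≈ f′ C.∙ a → ∀ x →
             Setoid._≈_ (F₀ A) (Func.to (F₁ a) (Func.to (F₁ f′) x)) (Func.to (F₁ f) (Func.to (F₁ b) x))
    square {A} p x = PA.trans (PA.sym (F-∙ x)) (PA.trans (F-cong (C.Eq.sym p) x) (F-∙ x))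
      where module PA = Setoid (F₀ A)

    inverse : ∀ {A B} {a : A C.⇒ B} {b : B C.⇒ A} → b C.∙ a C.≈ C.id → ∀ x →
              Setoid._≈_ (F₀ A) (Func.to (F₁ a) (Func.to (F₁ b) x)) x
    inverse {A} p x = PA.trans (PA.sym (F-∙ x)) (PA.trans (F-cong p x) (F-id x))
      where module PA = Setoid (F₀ A)

    -- `P` is contravariant, so the component into `P` is restriction along `GF.to A`, which starts
    -- at `A`; the inverse uses `GF.from A`.
    counit : NaturalTransformation ((P ∘F opF G) ∘F opF F) P
    counit = record { η = λ A → F₁ (η GF.to A) ; natural = λ f → square (natural GF.to f) }
      where open NaturalTransformation

    counit⁻¹ : NaturalTransformation P ((P ∘F opF G) ∘F opF F)
    counit⁻¹ = record { η = λ A → F₁ (η GF.from A) ; natural = λ f → square (natural GF.from f) }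
      where open NaturalTransformation

  precompose-from : NaturalTransformation (F* ∘F G*) idF
  precompose-from = record
    { η       = λ (P , _) → counit P
    -- Naturality in the sheaf is naturality of `α` at the arrow `GF.to A`.
    ; natural = λ {_} {Q} α A x → Setoid.sym (Functor.F₀ (proj₁ Q) A) (natural α (η GF.to A) x)
    }
    where open NaturalTransformation

  precompose-to : NaturalTransformation idF (F* ∘F G*)
  precompose-to = record
    { η       = λ (P , _) → counit⁻¹ P
    ; natural = λ {_} {Q} α A x →
        Setoid.sym (Functor.F₀ (proj₁ Q) (H.F₀ A)) (natural α (η GF.from A) x)
    }
    where open NaturalTransformation

  precompose-inverse : Isomorphism (Functors (Sheaves κ C J) (Sheaves κ C J)) (F* ∘F G*) idF
  precompose-inverse = record
    { from       = precompose-from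
    ; to         = precompose-to
    ; to∙from≈id = λ (P , _) A → inverse P (GF.to∙from≈id A)
    ; from∙to≈id = λ (P , _) A → inverse P (GF.from∙to≈id A)
    }

-- Precomposition reverses direction, so `F` and `G` exchange places. Since each carries covers to
-- covers, `sheafFor-∘` makes both continuous.
Sheaves-≃ : ∀ {o h e o′ h′ e′ ι j j′ κ} {C : Category o h e} {D : Category o′ h′ e′}
  (J : ∀ {U} → Family ι C U → Set j) (K : ∀ {U} → Family ι D U → Set j′) (E : C ≃ D) →
  (∀ {U} (S : Family ι C U) → J S → K (mapFamily (_≃_.F E) S)) →
  (∀ {U} (S : Family ι D U) → K S → J (mapFamily (_≃_.G E) S)) →
  Sheaves κ C J ≃ Sheaves κ D K
Sheaves-≃ {κ = κ} J K E F-covers G-covers = record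
  { F    = precompose K J G G-continuous
  ; G    = precompose J K F F-continuous
  ; G∘F≅ = precompose-inverse J K F G F-continuous G-continuous G∘F≅
  ; F∘G≅ = precompose-inverse K J G F G-continuous F-continuous F∘G≅
  }
  where
  open _≃_ E
  F-continuous : Continuous κ J K F
  F-continuous P sheaf S c = sheafFor-∘ E P S (sheaf (mapFamily F S) (F-covers S c))
  G-continuous : Continuous κ K J G
  G-continuous P sheaf S c = sheafFor-∘ (≃-sym E) P S (sheaf (mapFamily G S) (G-covers S c))

-- Translations of theories

record SignatureMorphism {ℓ} (𝓢 𝓢′ : Signature ℓ) : Set ℓ where
  private
    module S = Syntax 𝓢
    module S′ = Syntax 𝓢′
  field
    constants : Func (Signature.Constants 𝓢) (Signature.Constants 𝓢′)
    relation  : ∀ {k} → Signature.Relation 𝓢 k → Signature.Relation 𝓢′ k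

  term : ∀ {n} → S.Term n → S′.Term n
  term (S.var i) = S′.var i
  term (S.con c) = S′.con (Func.to constants c)

  formula : ∀ {n} → S.Formula n → S′.Formula n
  formula (S.rel R ts) = S′.rel (relation R) (Vec.map term ts)
  formula (t S.≐ u)    = term t S′.≐ term u
  formula S.⊤′         = S′.⊤′
  formula (φ S.∧ ψ)    = formula φ S′.∧ formula ψ
  formula (S.⋁ I φ)    = S′.⋁ I λ i → formula (φ i)
  formula (S.∃′ φ)     = S′.∃′ (formula φ)

  formula-⋀ : ∀ {m n} (φ : Vector (S.Formula n) m) → formula (S.⋀ φ) ≡ S′.⋀ (formula ∘ φ)
  formula-⋀ {ℕ.zero}  φ = refl
  formula-⋀ {ℕ.suc m} φ = cong (formula (φ zero) S′.∧_) (formula-⋀ (φ ∘ suc))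

  formula-∃ⁿ : ∀ m {n} (φ : S.Formula (m + n)) → formula (S.∃ⁿ m φ) ≡ S′.∃ⁿ m (formula φ)
  formula-∃ⁿ ℕ.zero    φ = refl
  formula-∃ⁿ (ℕ.suc m) φ = formula-∃ⁿ m (S.∃′ φ)

  term-⟪⟫ : ∀ {m n} (t : S.Term m) {σ : S.Subst m n} {σ′ : S′.Subst m n} →
            (∀ i → term (σ i) ≡ σ′ i) → term (t S.⟪ σ ⟫) ≡ term t S′.⟪ σ′ ⟫
  term-⟪⟫ (S.var i) e = e i
  term-⟪⟫ (S.con c) e = refl

  map-term-⟪⟫ : ∀ {m n k} (ts : Vec (S.Term m) k) {σ : S.Subst m n} {σ′ : S′.Subst m n} →
                (∀ i → term (σ i) ≡ σ′ i) →
                Vec.map term (Vec.map (S._⟪ σ ⟫) ts) ≡ Vec.map (S′._⟪ σ′ ⟫) (Vec.map term ts)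
  map-term-⟪⟫ []       e = refl
  map-term-⟪⟫ (t ∷ ts) e = cong₂ _∷_ (term-⟪⟫ t e) (map-term-⟪⟫ ts e)

  term-lift : ∀ {m n} {σ : S.Subst m n} {σ′ : S′.Subst m n} →
              (∀ i → term (σ i) ≡ σ′ i) → ∀ i → term (S.lift σ i) ≡ S′.lift σ′ i
  term-lift e zero            = refl
  term-lift {σ = σ} e (suc i) =
    trans (term-⟪⟫ (σ i) (λ _ → refl)) (cong (S′._⟪ S′.var ∘ suc ⟫) (e i))

  term-++ : ∀ {m n p} {us : S.Subst m p} {ts : S.Subst n p}
            {us′ : S′.Subst m p} {ts′ : S′.Subst n p} →
            (∀ i → term (us i) ≡ us′ i) → (∀ i → term (ts i) ≡ ts′ i) →
            ∀ i → term ((us ++ ts) i) ≡ (us′ ++ ts′) i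
  term-++ {m} e f i with splitAt m i
  ... | inj₁ j = e j
  ... | inj₂ j = f j

record TheoryMorphism {ℓ} (T T′ : Theory ℓ) : Set (lsuc ℓ) where
  private
    module L = Logic T
  open Logic T′
  field
    signatureMorphism : SignatureMorphism (Theory.signature T) (Theory.signature T′)

  open SignatureMorphism signatureMorphism public

  field
    axioms : ∀ {n} {φ ψ : L.Formula n} → Theory.Axiom T φ ψ → formula φ ⊢ formula ψ

  -- Under `⋁` a propositional equality would need function extensionality, hence provable
  -- equivalence. Assuming only pointwise agreement with `σ′` lets the induction pass under `lift`.
  formula-[] : ∀ {m n} (φ : L.Formula m) {σ : L.Subst m n} {σ′ : Subst m n} →
               (∀ i → term (σ i) ≡ σ′ i) → formula (φ L.[ σ ]) ⊣⊢ formula φ [ σ′ ]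
  formula-[] (L.rel R ts) e = by-≡ (cong (rel (relation R)) (map-term-⟪⟫ ts e))
                            , by-≡ (cong (rel (relation R)) (sym (map-term-⟪⟫ ts e)))
  formula-[] (t L.≐ u) e = by-≡ (cong₂ _≐_ (term-⟪⟫ t e) (term-⟪⟫ u e))
                         , by-≡ (sym (cong₂ _≐_ (term-⟪⟫ t e) (term-⟪⟫ u e)))
  formula-[] L.⊤′ e = ⊢-refl , ⊢-refl
  formula-[] (φ L.∧ ψ) e = ∧-mono (proj₁ (formula-[] φ e)) (proj₁ (formula-[] ψ e))
                         , ∧-mono (proj₂ (formula-[] φ e)) (proj₂ (formula-[] ψ e))
  formula-[] (L.⋁ I φ) e = ⋁-mono (λ i → proj₁ (formula-[] (φ i) e))
                         , ⋁-mono (λ i → proj₂ (formula-[] (φ i) e))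
  formula-[] (L.∃′ φ) e = ∃-mono (proj₁ (formula-[] φ (term-lift e)))
                        , ∃-mono (proj₂ (formula-[] φ (term-lift e)))

  -- Induction on the derivation: each rule goes to the same rule, with `formula-[]` and `formula-⋀`
  -- correcting for substitutions and tuples of equations.
  formula-⊢ : ∀ {n} {φ ψ : L.Formula n} → φ L.⊢ ψ → formula φ ⊢ formula ψ
  formula-⊢ (L.axiom a) = axioms a
  formula-⊢ L.⊢-refl = ⊢-refl
  formula-⊢ (L.cut p q) = cut (formula-⊢ p) (formula-⊢ q)
  formula-⊢ (L.sub {φ = φ} {ψ} σ p) =
    cut (proj₁ (formula-[] φ (λ _ → refl)))
    (cut (sub (term ∘ σ) (formula-⊢ p)) (proj₂ (formula-[] ψ (λ _ → refl))))
  formula-⊢ L.≐-refl = ≐-refl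
  formula-⊢ (L.≐-con e) = ≐-con (Func.cong constants e)
  formula-⊢ (L.≐-subst φ σ τ) =
    cut (∧-mono (by-≡ (formula-⋀ λ i → σ i L.≐ τ i)) (proj₁ (formula-[] φ (λ _ → refl))))
    (cut (≐-subst (formula φ) (term ∘ σ) (term ∘ τ)) (proj₂ (formula-[] φ (λ _ → refl))))
  formula-⊢ L.⊤-intro = ⊤-intro
  formula-⊢ L.∧-elimˡ = ∧-elimˡ
  formula-⊢ L.∧-elimʳ = ∧-elimʳ
  formula-⊢ (L.∧-intro p q) = ∧-intro (formula-⊢ p) (formula-⊢ q)
  formula-⊢ (L.⋁-intro i) = ⋁-intro i
  formula-⊢ (L.⋁-elim p) = ⋁-elim λ i → formula-⊢ (p i)
  formula-⊢ (L.∃-intro {ψ = ψ} p) =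
    cut (∃-intro (formula-⊢ p)) (proj₂ (formula-[] ψ (λ _ → refl)))
  formula-⊢ (L.∃-elim {ψ = ψ} p) =
    ∃-elim (cut (formula-⊢ p) (proj₁ (formula-[] ψ (λ _ → refl))))
  formula-⊢ L.distributive = distributive
  formula-⊢ (L.frobenius {φ = φ}) =
    cut frobenius (∃-mono (∧-mono (proj₂ (formula-[] φ (λ _ → refl))) ⊢-refl))

-- Functors between syntactic categories

module SyntacticFunctor {ℓ} {T T′ : Theory ℓ} (h : TheoryMorphism T T′) where
  open TheoryMorphism h
  private
    module L = Logic T
    module S = SyntacticSite T
  open Logic T′
  open SyntacticSite T′
  open Object
  open Morphism

  object : S.Object → Object
  object S.⟨ n ∣ φ ⟩ = ⟨ n ∣ formula φ ⟩

  -- The three conditions on a graph are derivable sequents, hence survive `formula-⊢`; what remains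
  -- is moving `formula` past substitutions, `∃ⁿ` and `≐ⁿ`.
  morphism : ∀ {X Y} → S.Morphism X Y → Morphism (object X) (object Y)
  morphism {X} {Y} θ = record
    { graph      = formula θ.graph
    ; bounded    = cut (formula-⊢ θ.bounded) (∧-mono (proj₁ (formula-[] X.fml (λ _ → refl)))
                                                     (proj₁ (formula-[] Y.fml (λ _ → refl))))
    ; total      = cut (formula-⊢ θ.total) (by-≡ (formula-∃ⁿ Y.ctx θ.graph))
    ; functional =
        cut (∧-mono (proj₂ (formula-[] θ.graph (term-++ {m = Y.ctx} (λ _ → refl) (λ _ → refl))))
                    (proj₂ (formula-[] θ.graph (term-++ {m = Y.ctx} (λ _ → refl) (λ _ → refl)))))
        (cut (formula-⊢ θ.functional)
             (by-≡ (formula-⋀ λ i → L.genⁿ Y.ctx i L.≐ (L.genⁿ Y.ctx L.⨟ L.wkⁿ Y.ctx) i)))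
    }
    where
    module X = S.Object X
    module Y = S.Object Y
    module θ = S.Morphism θ

  functor : Functor S.syntacticCategory syntacticCategory
  functor = record
    { F₀     = object
    ; F₁     = morphism
    ; F-cong = λ (p , q) → formula-⊢ p , formula-⊢ q
    ; F-id   = λ {X} → let n = S.Object.ctx X ; φ = S.Object.fml X in
        ∧-mono (proj₁ (formula-[] φ (λ _ → refl)))
               (by-≡ (formula-⋀ λ i → L.genⁿ n i L.≐ L.wkⁿ n i)) ,
        ∧-mono (proj₂ (formula-[] φ (λ _ → refl)))
               (by-≡ (sym (formula-⋀ λ i → L.genⁿ n i L.≐ L.wkⁿ n i)))
    ; F-∙    = λ {X} {Y} {Z} {θ′} {θ} →
        let n = S.Object.ctx X ; m = S.Object.ctx Y ; k = S.Object.ctx Z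
            a = formula-[] (S.Morphism.graph θ) (term-++ {m = m} (λ _ → refl) (λ _ → refl))
            b = formula-[] (S.Morphism.graph θ′) (term-++ {m = k} (λ _ → refl) (λ _ → refl))
            e = formula-∃ⁿ m (S.compᵇ k m n (S.Morphism.graph θ′) (S.Morphism.graph θ))
        in cut (by-≡ e) (∃ⁿ-mono m (∧-mono (proj₁ a) (proj₁ b))) ,
           cut (∃ⁿ-mono m (∧-mono (proj₂ a) (proj₂ b))) (by-≡ (sym e))
    }

  -- Covering is a single entailment, so it is translated as a whole; the index set stays the same
  -- and the images are matched one by one.
  functor-covers : ∀ {U} (F : Family ℓ S.syntacticCategory U) →
                   S.Covers F → Covers (mapFamily functor F)
  functor-covers {U} F c = cut (formula-⊢ c) (⋁-mono λ i →
    let m = S.Object.ctx (source i)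
        θ = S.Morphism.graph (arrow i)
    in cut (by-≡ (formula-∃ⁿ m (θ L.[ L.wkⁿ m ++ L.genⁿ m ])))
           (∃ⁿ-mono m (proj₁ (formula-[] θ
             (term-++ {m = S.Object.ctx U} (λ _ → refl) (λ _ → refl))))))
    where open Family F

module _ {ℓ} {T : Theory ℓ} where
  open Logic T

  -- `rel R ts` is the instance at `lookup ts` of the atom in distinct variables, so `transport`
  -- replaces all arguments at once.
  rel-cong : ∀ {k n} {R R′ : Relation k} {ts us : Vec (Term n) k} {χ : Formula n} → R ≡ R′ →
             (∀ i → χ ⊢ lookup ts i ≐ lookup us i) → χ ⊢ rel R ts → χ ⊢ rel R′ us
  rel-cong {R = R} {ts = ts} {us} refl e p =
    cut (transport (rel R (tabulate var)) e (cut p (by-≡ (cong (rel R) (sym (instance-≡ ts))))))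
        (by-≡ (cong (rel R) (instance-≡ us)))
    where
    instance-≡ : ∀ {k n} (ts : Vec (Term n) k) →
                 Vec.map (_⟪ lookup ts ⟫) (tabulate var) ≡ ts
    instance-≡ ts = trans (sym (tabulate-∘ (_⟪ lookup ts ⟫) var)) (tabulate∘lookup ts)

-- Inclusions induced by entailments

module _ {ℓ} (T : Theory ℓ) where
  open Logic T
  open SyntacticSite T
  open Morphism

  -- The inclusion of `φ` into `ψ`: its graph is that of the identity on `φ`, and the entailment
  -- enters in the codomain bound.
  coerce : ∀ {n} {φ ψ : Formula n} → φ ⊢ ψ → Morphism ⟨ n ∣ φ ⟩ ⟨ n ∣ ψ ⟩
  coerce {n} {φ} {ψ} e = mkMorphism (idᶠ X)
    (λ a → idᶠ-fml X a
         , transport ψ (λ i → ≐-sym (idᶠ-eq X a i)) (cut (idᶠ-fml X a) (sub _ e)))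
    (λ {_} {ts} a → ∃ⁿ-intro n (idᶠ X) ts (idᶠ-intro X a (λ i → ≐-by-≡ refl)))
    (λ a b i → ≐-trans (idᶠ-eq X a i) (≐-sym (idᶠ-eq X b i)))
    where
    X = ⟨ n ∣ φ ⟩

  coerce-inverse : ∀ {n} {φ ψ : Formula n} (p : φ ⊢ ψ) (q : ψ ⊢ φ) →
                   coerce q ∙ᴹ coerce p ≈ᴹ idᴹ
  coerce-inverse {n} {φ} {ψ} p q = ≈ᴹ-by-⊢ (coerce q ∙ᴹ coerce p) idᴹ λ a →
    comp-elim n n n (idᶠ Y) (idᶠ X) a λ ρ ys w b c → fuse₂ n (idᶠ X)
      (idᶠ-intro X (idᶠ-fml X b) (λ i → ≐-trans (idᶠ-eq Y c i) (idᶠ-eq X b i)))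
    where
    X = ⟨ n ∣ φ ⟩
    Y = ⟨ n ∣ ψ ⟩

  -- A one-sided entailment between the graphs is enough, because comparable functional relations
  -- are equivalent.
  coerce-natural : ∀ {m n} {φ φ′ : Formula m} {ψ ψ′ : Formula n}
    (p : φ ⊢ φ′) (q : ψ ⊢ ψ′)
    (θ : Morphism ⟨ m ∣ φ ⟩ ⟨ n ∣ ψ ⟩) (θ′ : Morphism ⟨ m ∣ φ′ ⟩ ⟨ n ∣ ψ′ ⟩) →
    graph θ ⊢ graph θ′ → coerce q ∙ᴹ θ ≈ᴹ θ′ ∙ᴹ coerce p
  coerce-natural {m} {n} {φ} {φ′} {ψ} {ψ′} p q θ θ′ e =
    ≈ᴹ-by-⊢ (coerce q ∙ᴹ θ) (θ′ ∙ᴹ coerce p) λ {_} {_} {xs} a →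
    comp-elim n n m (idᶠ ⟨ n ∣ ψ ⟩) (graph θ) a λ ρ ys w b c →
    fuse₂ n (graph (θ′ ∙ᴹ coerce p))
      -- The intermediate point is the argument itself, since `coerce p` leaves it in place.
      (comp-intro n m m (graph θ′) (idᶠ ⟨ m ∣ φ ⟩) (xs ⨟ ρ)
        (idᶠ-intro ⟨ m ∣ φ ⟩ (bounded-dom θ b) (λ i → ≐-by-≡ refl))
        (transport (graph θ′)
          (++-≐ (λ i → ≐-sym (idᶠ-eq ⟨ n ∣ ψ ⟩ c i)) (λ i → ≐-by-≡ refl))
          (cut b (sub _ e))))

-- Mutually inverse translations

module _ {ℓ} {T T′ : Theory ℓ} (h : TheoryMorphism T T′) (k : TheoryMorphism T′ T) where
  private
    module h = TheoryMorphism h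
    module k = TheoryMorphism k
  open Logic T

  record LeftInverse : Set ℓ where
    field
      constants-inverse : ∀ c → Func.to k.constants (Func.to h.constants c) ≈ᶜ c
      relation-inverse  : ∀ {n} (R : Relation n) → k.relation (h.relation R) ≡ R

    term-inverse : ∀ {n} {χ : Formula n} (t : Term n) → χ ⊢ k.term (h.term t) ≐ t
    term-inverse (var i) = ≐-by-≡ refl
    term-inverse (con c) = cut ⊤-intro (≐-con (constants-inverse c))

    map-term-inverse : ∀ {n m} {χ : Formula n} (ts : Vec (Term n) m) i →
      χ ⊢ lookup (Vec.map k.term (Vec.map h.term ts)) i ≐ lookup ts i
    map-term-inverse ts i = ≐-trans
      (≐-by-≡ (trans (lookup-map i k.term (Vec.map h.term ts)) (cong k.term (lookup-map i h.term ts))))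
      (term-inverse (lookup ts i))

    -- Going back and forth replaces constants by provably equal ones; `rel-cong` handles the atoms,
    -- and the connectives preserve equivalence.
    formula-inverse : ∀ {n} (φ : Formula n) → k.formula (h.formula φ) ⊣⊢ φ
    formula-inverse (rel R ts) =
      rel-cong (relation-inverse R) (map-term-inverse ts) ⊢-refl ,
      rel-cong (sym (relation-inverse R)) (λ i → ≐-sym (map-term-inverse ts i)) ⊢-refl
    formula-inverse (t ≐ u) =
      ≐-trans (≐-sym (term-inverse t)) (≐-trans ⊢-refl (term-inverse u)) ,
      ≐-trans (term-inverse t) (≐-trans ⊢-refl (≐-sym (term-inverse u)))
    formula-inverse ⊤′ = ⊢-refl , ⊢-refl
    formula-inverse (φ ∧ ψ) =
      ∧-mono (proj₁ (formula-inverse φ)) (proj₁ (formula-inverse ψ)) ,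
      ∧-mono (proj₂ (formula-inverse φ)) (proj₂ (formula-inverse ψ))
    formula-inverse (⋁ I φ) =
      ⋁-mono (λ i → proj₁ (formula-inverse (φ i))) ,
      ⋁-mono (λ i → proj₂ (formula-inverse (φ i)))
    formula-inverse (∃′ φ) =
      ∃-mono (proj₁ (formula-inverse φ)) , ∃-mono (proj₂ (formula-inverse φ))

    -- Each object keeps its context and gets an equivalent formula, so `coerce` supplies the
    -- components; `formula-inverse` at graphs gives naturality.
    functor-inverse :
      Isomorphism (Functors (SyntacticSite.syntacticCategory T) (SyntacticSite.syntacticCategory T))
        (SyntacticFunctor.functor k ∘F SyntacticFunctor.functor h) idF
    functor-inverse = record
      { from = record
        { η       = λ X → coerce T (proj₁ (formula-inverse (fml X)))
        ; natural = λ {X} {Y} θ → coerce-natural T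
            (proj₁ (formula-inverse (fml X))) (proj₁ (formula-inverse (fml Y)))
            (SyntacticFunctor.morphism k (SyntacticFunctor.morphism h θ)) θ
            (proj₁ (formula-inverse (graph θ)))
        }
      ; to = record
        { η       = λ X → coerce T (proj₂ (formula-inverse (fml X)))
        ; natural = λ {X} {Y} θ → coerce-natural T
            (proj₂ (formula-inverse (fml X))) (proj₂ (formula-inverse (fml Y)))
            θ (SyntacticFunctor.morphism k (SyntacticFunctor.morphism h θ))
            (proj₂ (formula-inverse (graph θ)))
        }
      ; to∙from≈id = λ X → coerce-inverse T
          (proj₁ (formula-inverse (fml X))) (proj₂ (formula-inverse (fml X)))
      ; from∙to≈id = λ X → coerce-inverse T
          (proj₂ (formula-inverse (fml X))) (proj₁ (formula-inverse (fml X)))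
      }
      where
      open SyntacticSite.Object
      open SyntacticSite.Morphism

ClassifyingTopos-≃ : ∀ {ℓ} {T T′ : Theory ℓ}
  (h : TheoryMorphism T T′) (k : TheoryMorphism T′ T) →
  LeftInverse h k → LeftInverse k h → ClassifyingTopos T ≃ ClassifyingTopos T′
ClassifyingTopos-≃ {T = T} {T′} h k kh≈id hk≈id = Sheaves-≃
  (SyntacticSite.Covers T) (SyntacticSite.Covers T′)
  (record
    { F    = H.functor
    ; G    = K.functor
    ; G∘F≅ = LeftInverse.functor-inverse kh≈id
    ; F∘G≅ = LeftInverse.functor-inverse hk≈id
    })
  H.functor-covers K.functor-covers
  where
  module H = SyntacticFunctor h
  module K = SyntacticFunctor k

-- Transition systems

module Reachability {ℓ} (M : RootedTransitionSystem ℓ) where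
  open RootedTransitionSystem M

  ≈⇒⟶* : ∀ {s t} → s ≈ t → s ⟶* t
  ≈⇒⟶* p = inj₁ p ◅ ε

  -- The two paths, prepended or appended, turn a path at either state into one at the other.
  ∼-intro : ∀ {s t} → s ⟶* t → t ⟶* s → s ∼ t
  ∼-intro p q u = mk⇔ (q ◅◅_) (p ◅◅_) , mk⇔ (_◅◅ p) (_◅◅ q)

  -- The instance `u = t` of the definition, at the empty path.
  ∼⇒⟶* : ∀ {s t} → s ∼ t → s ⟶* t
  ∼⇒⟶* p = Equivalence.from (proj₁ (p _)) ε

  ∼⇒⟵* : ∀ {s t} → s ∼ t → t ⟶* s
  ∼⇒⟵* p = Equivalence.to (proj₁ (p _)) ε

module _ {ℓ} {M N : RootedTransitionSystem ℓ} (f : Simulation M N) where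
  private
    module M = RootedTransitionSystem M
    module N = RootedTransitionSystem N
    module f = Simulation f
    module RM = Reachability M
    module RN = Reachability N

  preserves-⟶* : ∀ {s t} → s M.⟶* t → f.to s N.⟶* f.to t
  preserves-⟶* = gmap f.to λ where
    (inj₁ p) → inj₁ (Func.cong f.func p)
    (inj₂ p) → inj₂ (f.preserves-⟶ p)

  -- The definition of `∼` in `N` also quantifies over states outside the image of `f`; mutual
  -- reachability does not mention them.
  preserves-∼ : ∀ {s t} → s M.∼ t → f.to s N.∼ f.to t
  preserves-∼ p = RN.∼-intro (preserves-⟶* (RM.∼⇒⟶* p)) (preserves-⟶* (RM.∼⇒⟵* p))

  _/∼ˢ : Simulation (M /∼) (N /∼)
  _/∼ˢ = record
    { func        = record { to = f.to ; cong = preserves-∼ }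
    ; preserves-⟶ = λ (s , t , p , q , r) →
        f.to s , f.to t , preserves-∼ p , preserves-∼ q , f.preserves-⟶ r
    ; preserves-⋆ = ≈⇒∼ f.preserves-⋆
    }
    where
    ≈⇒∼ : ∀ {s t} → s N.≈ t → s N.∼ t
    ≈⇒∼ p = RN.∼-intro (RN.≈⇒⟶* p) (RN.≈⇒⟶* (Setoid.sym N.states p))

-- Translation along an isomorphism of transition systems

module _ {ℓ} {M N : RootedTransitionSystem ℓ} (f : Simulation M N) (g : Simulation N M) where
  private
    module M = RootedTransitionSystem M
    module N = RootedTransitionSystem N
    module f = Simulation f
    module g = Simulation g
    module RM = Reachability M
    module RN = Reachability N

  module _ (gf≈id : ∀ s → g.to (f.to s) M.≈ s) where

    -- `g` carries the path back, and `gf≈id` corrects its endpoints. The axioms denying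
    -- reachability rely on this.
    reflects-⟶* : ∀ {s t} → f.to s N.⟶* f.to t → s M.⟶* t
    reflects-⟶* {s} {t} p =
      RM.≈⇒⟶* (Setoid.sym M.states (gf≈id s)) ◅◅ preserves-⟶* g p ◅◅ RM.≈⇒⟶* (gf≈id t)

    reflects-∼ : ∀ {s t} → f.to s N.∼ f.to t → s M.∼ t
    reflects-∼ p = RM.∼-intro (reflects-⟶* (RN.∼⇒⟶* p)) (reflects-⟶* (RN.∼⇒⟵* p))

    module _ (fg≈id : ∀ t → f.to (g.to t) N.≈ t) where
      private
        module TM = TransitionTheory M
        module TN = TransitionTheory N
      open Logic (𝕋 N)

      -- `Δ-step` holds since `f` preserves transitions, the negative axioms since `f` reflects
      -- paths, and the axioms with disjunctions over states since every constant of `N` equals one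
      -- in the image of `f`.
      translation : TheoryMorphism (𝕋 M) (𝕋 N)
      translation = record { signatureMorphism = σ ; axioms = axioms }
        where
        σ : SignatureMorphism TM.signature TN.signature
        σ = record { constants = f.func ; relation = λ R → R }

        rename-con : ∀ {n} {t : Term n} u → t ≐ con u ⊢ t ≐ con (f.to (g.to u))
        rename-con u =
          ≐-trans ⊢-refl (cut ⊤-intro (≐-con (Setoid.sym N.states (fg≈id u))))

        axioms : ∀ {n} {φ ψ : Logic.Formula (𝕋 M) n} → TM.Axiom φ ψ →
                 SignatureMorphism.formula σ φ ⊢ SignatureMorphism.formula σ ψ
        axioms TM.Δ⊢Γ       = axiom TN.Δ⊢Γ
        axioms TM.Γ-refl    = axiom TN.Γ-refl
        axioms TM.Γ-trans   = axiom TN.Γ-trans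
        axioms TM.Θ-def⇒    = axiom TN.Θ-def⇒
        axioms TM.Θ-def⇐    = axiom TN.Θ-def⇐
        axioms TM.Θ-sym     = axiom TN.Θ-sym
        axioms TM.Θ⊢Γ       = axiom TN.Θ⊢Γ
        axioms (TM.Δ-step p) = axiom (TN.Δ-step (f.preserves-⟶ p))
        axioms (TM.Δ-target s) = cut (axiom (TN.Δ-target (f.to s))) (⋁-elim λ (u , p) →
          -- The disjunct for `u` is the one indexed by `g u`, a successor of `s` because `g` takes
          -- `f s` back to `s`.
          cut (rename-con u)
            (⋁-intro (g.to u , proj₂ M.⟶-resp-≈ (gf≈id s) (g.preserves-⟶ p))))
        -- `⊥′` translates to an empty disjunction over another family, so the two are related by
        -- `⋁-elim` rather than identified.
        axioms (TM.¬Γ ¬p) = cut (axiom (TN.¬Γ (¬p ∘ reflects-⟶*))) (⋁-elim λ ())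
        axioms (TM.¬Θ ¬p) = cut (axiom (TN.¬Θ (¬p ∘ reflects-∼))) (⋁-elim λ ())
        axioms TM.domain-closure = cut (axiom TN.domain-closure) (⋁-elim λ u →
          cut (rename-con u) (⋁-intro (g.to u)))

mainTheorem5 : ∀ {ℓ} (M N : RootedTransitionSystem ℓ) →
    FunctionalBisimulation M N →
    ClassifyingTopos (𝕋 (M /∼)) ≃ ClassifyingTopos (𝕋 (N /∼))
mainTheorem5 M N B = ClassifyingTopos-≃
  -- Equality of states in a quotient is `∼`, so the conditions of the bisimulation say that the
  -- induced simulations are mutually inverse.
  (translation (f /∼ˢ) (g /∼ˢ) gf∼id fg∼id) (translation (g /∼ˢ) (f /∼ˢ) fg∼id gf∼id)
  (record { constants-inverse = gf∼id ; relation-inverse = λ _ → refl })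
  (record { constants-inverse = fg∼id ; relation-inverse = λ _ → refl })
  where open FunctionalBisimulation B
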